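{- Let $p>3$ be a prime, let $a\in\mathbb{Z}_p$ with $a\not\equiv 0\pmod p$, let $\langle a\rangle_p$ be the least nonnegative residue of $a$ modulo $p$, and let $t=(a-\langle a\rangle_p)/p$. Then $$\sum_{k=0}^{(p-1)/2}\frac{\binom ak\binom{ -1-a}k}{2k-1}\equiv\begin{cases}2pt-(2a+1)\sum_{k=0}^{p-1}\binom{2a}k(-2)^k\pmod{p^2}&\text{if }\langle a\rangle_p<\frac p2,\\ 2p(t+1)-\frac{2a+1}{2t+1}-(2a+1)\big(1+\frac1{2t+1}\big)\sum_{k=0}^{p-1}\binom{2a}k(-2)^k\pmod{p^2}&\text{if }\langle a\rangle_p>\frac p2\text{ and }t\not\equiv-\frac12\pmod p,\\ 2a+1+p\big(1+(2a+1)E_{p-2}(-2a)\big)\pmod{p^2}&\text{if }\langle a\rangle_p>\frac p2\text{ and }t\equiv-\frac12\pmod p.\end{cases}$$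
   Context: $\mathbb{Z}_p$ denotes the set of rational numbers whose denominator is not divisible by $p$; congruences modulo $p^m$ are taken in $\mathbb{Z}_p$. For $a\in\mathbb{Z}_p$, $\langle a\rangle_p\in\{0,1,\dots,p-1\}$ satisfies $\langle a\rangle_p\equiv a\pmod p$. $\binom xk=x(x-1)\cdots(x-k+1)/k!$. The Euler numbers are defined by $E_0=1$, $E_n=-\sum_{k=1}^{[n/2]}\binom n{2k}E_{n-2k}$ ($n\ge1$), and the Euler polynomials by $E_n(x)=2^{ -n}\sum_{r=0}^n\binom nr(2x-1)^{n-r}E_r$. -}

module Defs where

open import Data.Nat as ℕ using (ℕ; zero; suc)
open import Data.Nat.Divisibility using (_∣_)
open import Data.Nat.Combinatorics using (_C_)
open import Data.Integer as ℤ using (ℤ; +_; -[1+_]; +[1+_])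
open import Data.Rational as ℚ using (ℚ; mkℚ; ↧ₙ_; _+_; _*_; _-_; -_; 0ℚ; 1ℚ; 1/_)
open import Data.List using (List; []; _∷_)
open import Data.Product using (Σ; _×_)
open import Relation.Nullary using (¬_)
open import Relation.Binary.PropositionalEquality using (_≡_)

ℕ→ℚ : ℕ → ℚ
ℕ→ℚ n = (+ n) ℚ./ 1

-- total reciprocal (inv 0 = 0); only ever applied to nonzero arguments below
inv : ℚ → ℚ
inv (mkℚ (+ zero) d prf) = 0ℚ
inv (mkℚ +[1+ n ] d prf) = mkℚ +[1+ d ] n (ℕ.sym prf)
  where import Data.Nat.Coprimality as ℕ
inv (mkℚ -[1+ n ] d prf) = mkℚ -[1+ d ] n (ℕ.sym prf)
  where import Data.Nat.Coprimality as ℕ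

_^ℚ_ : ℚ → ℕ → ℚ
x ^ℚ zero = 1ℚ
x ^ℚ suc n = (x ^ℚ n) * x

Σ[0≤k≤_] : ℕ → (ℕ → ℚ) → ℚ
Σ[0≤k≤ zero ] f = f 0
Σ[0≤k≤ suc n ] f = Σ[0≤k≤ n ] f + f (suc n)

binom : ℚ → ℕ → ℚ
binom x zero = 1ℚ
binom x (suc k) = binom x k * (x - ℕ→ℚ k) * inv (ℕ→ℚ (suc k))

InZp : ℕ → ℚ → Set
InZp p x = ¬ (p ∣ ↧ₙ x)

CongMod : ℕ → ℕ → ℚ → ℚ → Set
CongMod p m x y = Σ ℚ (λ z → InZp p z × (x - y ≡ ℕ→ℚ (p ℕ.^ m) * z))

-- Euler numbers.  eulerList n = [E_n, E_{n-1}, ..., E_0]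
-- E_0 = 1,  E_m = - Σ_{k=1}^{[m/2]} C(m,2k) E_{m-2k}.
-- With L = eulerList n = [E_n,...,E_0] and m = n+1, the entry at index i is
-- E_{m-(i+1)}; it contributes iff i+1 = 2k is even with k ≥ 1, i.e. i odd,
-- with coefficient C(m, i+1).
private
  eulerSum : ℕ → ℕ → List ℚ → ℚ
  eulerSum m i [] = 0ℚ
  eulerSum m i (e ∷ L) with ℕ._%_ i 2
  ... | 1 = ℕ→ℚ (m C suc i) * e + eulerSum m (suc i) L
  ... | _ = eulerSum m (suc i) L

eulerList : ℕ → List ℚ
eulerList zero = 1ℚ ∷ []
eulerList (suc n) = (- eulerSum (suc n) 0 (eulerList n)) ∷ eulerList n

E : ℕ → ℚ
E n with eulerList n
... | e ∷ _ = e
... | [] = 0ℚ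

Epoly : ℕ → ℚ → ℚ
Epoly n x = inv (ℕ→ℚ 2 ^ℚ n) *
  Σ[0≤k≤ n ] (λ r → ℕ→ℚ (n C r) * ((ℕ→ℚ 2 * x - 1ℚ) ^ℚ (n ℕ.∸ r)) * E r)

{-# OPTIONS --safe #-}

-- Write ε = p, so that ε² ≡ 0, and a = r + εt. Everything takes place in a commutative ring in
-- which ε² ≈ 0 and 1, …, p - 1 are invertible; the ring is ℤ_(p) modulo p² in the end.
--
-- For T(x) = Σ_{k<p} C(x,k)(-2)^k, Pascal's rule gives T(x+1) + T(x) = -(-2)^p C(x,p-1), hence
-- T(s + εt) = (-1)^s + εt L(s) with L(s+1) + L(s) = 2/(s+1). Comparing T(p) = T(-1) yields the
-- antisymmetry εL(p-1-s) = -εL(s). For the left-hand side S(a), a telescoping identity gives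
--   (2a+1) S(a+1) - (2a+3) S(a) = 2 C(a,n) C(-2-a,n),   n = (p-1)/2,
-- and induction on r ≤ n starting from S(εt) = -1 - 2εt L(0) shows
--   S(r + εt) = 2εt - (2a+1)(1 + 2εt L(2r)).
-- Residues r > n reduce to this by S(a) = S(-1-a), together with the antisymmetry of L. In the
-- exceptional case one needs εE_{p-2}(s+1) = εL(s): both sides satisfy the same first-order
-- recurrence (by Fermat) and the same reflection.
module Submission where

open import Defs
open import Level using (Level)
open import Algebra using (CommutativeRing)
import Algebra.Solver.Ring as Ring-Solver
open import Algebra.Solver.Ring.AlmostCommutativeRing
  using (_-Raw-AlmostCommutative⟶_; fromCommutativeRing)
open import Data.Nat as ℕ using (ℕ; zero; suc; z≤n; s≤s; ⌊_/2⌋; _∸_)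
import Data.Nat.Properties as ℕₚ
open import Data.Nat.Combinatorics
  using (_C_; nCn≡1; nCk≡nC[n∸k]; k>n⇒nCk≡0; nCk+nC[k+1]≡[n+1]C[k+1])
open import Data.Nat.Divisibility using (_∣_; divides; ∣1⇒≡1; ∣m⇒∣m*n; ∣⇒≤)
open import Data.Nat.Primality using (Prime; ¬prime[1]; euclidsLemma; prime⇒irreducible)
open import Data.Nat.Solver renaming (module +-*-Solver to ℕ-Solver)
open import Data.Integer as ℤ using (ℤ; +_; +[1+_]; -[1+_]; _⊖_)
open import Data.Integer.GCD using (gcd)
import Data.Integer.Properties as ℤₚ
import Data.Sign as Sign
open import Data.Rational as ℚ using (ℚ; mkℚ)
import Data.Rational.Properties as ℚₚ
open import Data.Rational.Unnormalised as ℚᵘ using (mkℚᵘ)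
import Data.Rational.Unnormalised.Properties as ℚᵘₚ
open import Data.List using (List; []; _∷_)
open import Data.Maybe using (Maybe; just; nothing)
open import Data.Product using (Σ; _,_)
open import Data.Sum using (_⊎_; inj₁; inj₂)
open import Relation.Nullary using (¬_; yes; no; contradiction)
open import Relation.Binary.PropositionalEquality as ≡ using (_≡_; _≢_)

-- The ring knows only the modulus p², so congruence modulo p is written `ε * x ≈ ε * y`. Since ε
-- cannot be cancelled, the antisymmetry of L and its comparison with the Euler polynomial carry a
-- factor ε throughout. Only units can be divided by, and this fixes the range of the main
-- induction: the recurrence for S is solved for S(a + 1) by dividing by 2a + 1 ≡ 2r + 1, which is a
-- unit as long as r < n. The inhomogeneous terms of the recurrences for T and S are C(r + εt, p -
-- 1) and C(a, n) C(-2 - a, n). In the relevant ranges both equal εt/(r + 1), although for different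
-- reasons, and this makes both recurrences solvable by the same function L. Identities modulo such
-- relations are proved by certificates: left minus right is an explicit linear combination of known
-- equations. The expressions in braces after `*-congˡ` are mostly the cofactors, and the solver
-- checks the resulting polynomial identity.

-- Ring solving with integer coefficients in any commutative ring.

module IntegerSolver {c ℓ : Level} (R : CommutativeRing c ℓ) where
  open CommutativeRing R
  open import Algebra.Properties.Ring ring
  open import Algebra.Properties.AbelianGroup +-abelianGroup using (⁻¹-∙-comm)
  open import Algebra.Properties.Semiring.Mult.TCOptimised semiring
  open import Relation.Binary.Reasoning.Setoid setoid

  -- Integers have decidable equality, which the carrier need not have. With the optimised multiple,
  -- `1 × 1#` and `2 × 1#` compute to `1#` and `1# + 1#`, so `con (+ 1)` and `con (+ 2)` match the
  -- terms of the goals literally.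
  ⟦_⟧ℤ : ℤ → Carrier
  ⟦ + n ⟧ℤ = n × 1#
  ⟦ -[1+ n ] ⟧ℤ = - (suc n × 1#)

  private
    ⊖-homo : ∀ m n → ⟦ m ⊖ n ⟧ℤ ≈ m × 1# - n × 1#
    ⊖-homo m zero = sym (trans (+-congˡ -0#≈0#) (+-identityʳ _))
    ⊖-homo zero (suc n) = sym (+-identityˡ _)
    ⊖-homo (suc m) (suc n) = begin
      ⟦ suc m ⊖ suc n ⟧ℤ              ≡⟨ ≡.cong ⟦_⟧ℤ (ℤₚ.[1+m]⊖[1+n]≡m⊖n m n) ⟩
      ⟦ m ⊖ n ⟧ℤ                      ≈⟨ ⊖-homo m n ⟩
      m × 1# - n × 1#                 ≈⟨ +-congʳ (+-identityʳ _) ⟨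
      (m × 1# + 0#) - n × 1#          ≈⟨ +-congʳ (+-congˡ (-‿inverseʳ 1#)) ⟨
      (m × 1# + (1# - 1#)) - n × 1#   ≈⟨ +-congʳ (+-assoc _ _ _) ⟨
      ((m × 1# + 1#) - 1#) - n × 1#   ≈⟨ +-assoc _ _ _ ⟩
      (m × 1# + 1#) + (- 1# - n × 1#) ≈⟨ +-cong (+-comm _ _) (⁻¹-∙-comm 1# (n × 1#)) ⟩
      (1# + m × 1#) - (1# + n × 1#)   ≈⟨ +-cong (1+× m 1#) (-‿cong (1+× n 1#)) ⟨
      suc m × 1# - suc n × 1#         ∎

    +-homo : ∀ i j → ⟦ i ℤ.+ j ⟧ℤ ≈ ⟦ i ⟧ℤ + ⟦ j ⟧ℤ
    +-homo (+ m) (+ n) = ×-homo-+ 1# m n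
    +-homo (+ m) -[1+ n ] = ⊖-homo m (suc n)
    +-homo -[1+ m ] (+ n) = trans (⊖-homo n (suc m)) (+-comm _ _)
    +-homo -[1+ m ] -[1+ n ] = begin
      - (suc (suc (m ℕ.+ n)) × 1#)      ≡⟨ ≡.cong (λ k → - (k × 1#)) (≡.cong suc (≡.sym (ℕₚ.+-suc m n))) ⟩
      - ((suc m ℕ.+ suc n) × 1#)        ≈⟨ -‿cong (×-homo-+ 1# (suc m) (suc n)) ⟩
      - (suc m × 1# + suc n × 1#)       ≈⟨ ⁻¹-∙-comm _ _ ⟨
      - (suc m × 1#) - (suc n × 1#)     ∎

    -‿homo : ∀ i → ⟦ ℤ.- i ⟧ℤ ≈ - ⟦ i ⟧ℤ
    -‿homo (+ zero) = sym -0#≈0#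
    -‿homo (+ suc n) = refl
    -‿homo -[1+ n ] = sym (-‿involutive _)

    *-homo : ∀ i j → ⟦ i ℤ.* j ⟧ℤ ≈ ⟦ i ⟧ℤ * ⟦ j ⟧ℤ
    *-homo (+ m) (+ n) = trans (reflexive (≡.cong ⟦_⟧ℤ (≡.sym (ℤₚ.pos-* m n)))) (×1-homo-* m n)
    *-homo (+ m) -[1+ n ] = begin
      ⟦ + m ℤ.* -[1+ n ] ⟧ℤ       ≡⟨ ≡.cong ⟦_⟧ℤ (ℤₚ.neg-distribʳ-* (+ m) (+ suc n)) ⟨
      ⟦ ℤ.- (+ m ℤ.* + suc n) ⟧ℤ  ≈⟨ -‿homo (+ m ℤ.* + suc n) ⟩
      - ⟦ + m ℤ.* + suc n ⟧ℤ      ≈⟨ -‿cong (*-homo (+ m) (+ suc n)) ⟩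
      - (m × 1# * (suc n × 1#))   ≈⟨ -‿distribʳ-* _ _ ⟩
      m × 1# * - (suc n × 1#)     ∎
    *-homo -[1+ m ] (+ n) = begin
      ⟦ -[1+ m ] ℤ.* + n ⟧ℤ       ≡⟨ ≡.cong ⟦_⟧ℤ (ℤₚ.neg-distribˡ-* (+ suc m) (+ n)) ⟨
      ⟦ ℤ.- (+ suc m ℤ.* + n) ⟧ℤ  ≈⟨ -‿homo (+ suc m ℤ.* + n) ⟩
      - ⟦ + suc m ℤ.* + n ⟧ℤ      ≈⟨ -‿cong (*-homo (+ suc m) (+ n)) ⟩
      - (suc m × 1# * (n × 1#))   ≈⟨ -‿distribˡ-* _ _ ⟩
      - (suc m × 1#) * (n × 1#)   ∎
    *-homo -[1+ m ] -[1+ n ] = begin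
      (suc m ℕ.* suc n) × 1#             ≈⟨ ×1-homo-* (suc m) (suc n) ⟩
      suc m × 1# * (suc n × 1#)          ≈⟨ -‿involutive _ ⟨
      - - (suc m × 1# * (suc n × 1#))    ≈⟨ -‿cong (-‿distribʳ-* _ _) ⟩
      - (suc m × 1# * - (suc n × 1#))    ≈⟨ -‿distribˡ-* _ _ ⟩
      - (suc m × 1#) * - (suc n × 1#)    ∎

    morphism : ℤ.+-*-rawRing -Raw-AlmostCommutative⟶ fromCommutativeRing R
    morphism = record
      { ⟦_⟧ = ⟦_⟧ℤ ; +-homo = +-homo ; *-homo = *-homo ; -‿homo = -‿homo
      ; 0-homo = refl ; 1-homo = refl }

    _coeff≟_ : ∀ i j → Maybe (⟦ i ⟧ℤ ≈ ⟦ j ⟧ℤ)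
    i coeff≟ j with i ℤ.≟ j
    ... | yes i≡j = just (reflexive (≡.cong ⟦_⟧ℤ i≡j))
    ... | no _ = nothing

  open Ring-Solver ℤ.+-*-rawRing (fromCommutativeRing R) morphism _coeff≟_ public
    using (solve; con; _:+_; _:*_; _:-_; :-_; _:=_)

-- Natural multiples, powers and finite sums in a ring.

module SequencesIn {c ℓ : Level} (R : CommutativeRing c ℓ) where
  open CommutativeRing R

  -- Written so that `ι (suc k)` unfolds to `1# + ι k`: neighbouring indices become polynomials in
  -- one solver variable.
  ι : ℕ → Carrier
  ι zero = 0#
  ι (suc k) = 1# + ι k

  pow : Carrier → ℕ → Carrier
  pow x zero = 1#
  pow x (suc k) = pow x k * x

  sum≤ : ℕ → (ℕ → Carrier) → Carrier
  sum≤ zero f = f 0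
  sum≤ (suc k) f = sum≤ k f + f (suc k)

  ι-+ : ∀ j k → ι (j ℕ.+ k) ≈ ι j + ι k
  ι-+ zero k = sym (+-identityˡ _)
  ι-+ (suc j) k = trans (+-congˡ (ι-+ j k)) (sym (+-assoc _ _ _))

  pow-cong : ∀ {x y} k → x ≈ y → pow x k ≈ pow y k
  pow-cong zero x≈y = refl
  pow-cong (suc k) x≈y = *-cong (pow-cong k x≈y) x≈y

  sum≤-cong : ∀ k {f g} → (∀ j → j ℕ.≤ k → f j ≈ g j) → sum≤ k f ≈ sum≤ k g
  sum≤-cong zero f≈g = f≈g 0 z≤n
  sum≤-cong (suc k) f≈g =
    +-cong (sum≤-cong k (λ j j≤k → f≈g j (ℕₚ.m≤n⇒m≤1+n j≤k))) (f≈g (suc k) ℕₚ.≤-refl)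

module TruncatedBinomialSums
  {c ℓ : Level} (R : CommutativeRing c ℓ) (n-1 : ℕ) where
  open CommutativeRing R
  open SequencesIn R

  n N p : ℕ
  n = suc n-1
  N = n ℕ.+ n
  p = suc N

  module ModuloP² (ν : ℕ → Carrier)
    (ν-inverse : ∀ {k} → k ℕ.< N → ι (suc k) * ν k ≈ 1#)
    (ε²≈0 : ι p * ι p ≈ 0#) where
    open IntegerSolver R
    open import Algebra.Properties.Ring ring
    open import Relation.Binary.Reasoning.Setoid setoid

    ε : Carrier
    ε = ι p

    -- The second hypothesis says l - r = a - b, in a form suited to the ring solver.
    by-difference : ∀ {a b l r} → a ≈ b → l + b ≈ r + a → l ≈ r
    by-difference {a} {b} {l} {r} a≈b l+b≈r+a =
      +-cancelʳ b l r (trans l+b≈r+a (+-congˡ a≈b))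

    cancel-unit : ∀ {u v x y} → u * v ≈ 1# → u * x ≈ u * y → x ≈ y
    cancel-unit {u} {v} {x} {y} uv≈1 ux≈uy = begin
      x            ≈⟨ *-identityˡ x ⟨
      1# * x       ≈⟨ *-congʳ uv≈1 ⟨
      u * v * x    ≈⟨ solve 3 (λ u v x → u :* v :* x := v :* (u :* x)) refl u v x ⟩
      v * (u * x)  ≈⟨ *-congˡ ux≈uy ⟩
      v * (u * y)  ≈⟨ solve 3 (λ u v x → v :* (u :* x) := u :* v :* x) refl u v y ⟩
      u * v * y    ≈⟨ *-congʳ uv≈1 ⟩
      1# * y       ≈⟨ *-identityˡ y ⟩
      y            ∎

    cancel-ι : ∀ {k x y} → k ℕ.< N → ι (suc k) * x ≈ ι (suc k) * y → x ≈ y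
    cancel-ι k<N = cancel-unit (ν-inverse k<N)

    -- Binomial coefficients modulo p².

    -- Division by k + 1 is multiplication by `ν k`, so this has its usual meaning for lower index
    -- at most N.
    binomial : Carrier → ℕ → Carrier
    binomial x zero = 1#
    binomial x (suc k) = binomial x k * (x - ι k) * ν k

    binomial-cong : ∀ {x y} k → x ≈ y → binomial x k ≈ binomial y k
    binomial-cong zero x≈y = refl
    binomial-cong (suc k) x≈y = *-congʳ (*-cong (binomial-cong k x≈y) (+-congʳ x≈y))

    binomial-suc : ∀ x {k} → k ℕ.< N → ι (suc k) * binomial x (suc k) ≈ binomial x k * (x - ι k)
    binomial-suc x {k} k<N = by-difference (*-congˡ {binomial x k * (x - ι k)} (ν-inverse k<N))
      (solve 4 (λ x k b v →
         (con (+ 1) :+ k) :* (b :* (x :- k) :* v) :+ b :* (x :- k) :* con (+ 1) :=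
         b :* (x :- k) :+ b :* (x :- k) :* ((con (+ 1) :+ k) :* v)) refl
       x (ι k) (binomial x k) (ν k))

    -- In the inductive step, multiplication by k + 1 lets the recursions chain: (k + 1)(k + 2)
    -- C(x+1, k+2) = (k + 1) C(x+1, k+1) (x - k) = (x + 1) C(x, k) (x - k) = (x + 1)(k + 1) C(x,
    -- k+1). Pascal's rule is then a consequence.
    absorption : ∀ x {k} → k ℕ.< N →
      ι (suc k) * binomial (1# + x) (suc k) ≈ (1# + x) * binomial x k
    absorption x {zero} k<N = trans (binomial-suc (1# + x) k<N)
      (solve 1 (λ x → con (+ 1) :* ((con (+ 1) :+ x) :- con (+ 0)) := (con (+ 1) :+ x) :* con (+ 1)) refl x)
    absorption x {suc k} k+1<N = cancel-ι k<N (by-difference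
      (+-cong (+-cong (*-congˡ {ι (suc k)} (binomial-suc (1# + x) k+1<N))
                      (*-congˡ {x - ι k} (absorption x k<N)))
              (*-congˡ {1# + x} (sym (binomial-suc x k<N))))
      (solve 6 (λ x k b₀ b₁ c₁ c₂ →
         (con (+ 1) :+ k) :* ((con (+ 1) :+ (con (+ 1) :+ k)) :* c₂)
           :+ ((con (+ 1) :+ k) :* (c₁ :* ((con (+ 1) :+ x) :- (con (+ 1) :+ k)))
             :+ (x :- k) :* ((con (+ 1) :+ x) :* b₀)
             :+ (con (+ 1) :+ x) :* ((con (+ 1) :+ k) :* b₁)) :=
         (con (+ 1) :+ k) :* ((con (+ 1) :+ x) :* b₁)
           :+ ((con (+ 1) :+ k) :* ((con (+ 1) :+ (con (+ 1) :+ k)) :* c₂)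
             :+ (x :- k) :* ((con (+ 1) :+ k) :* c₁)
             :+ (con (+ 1) :+ x) :* (b₀ :* (x :- k)))) refl
       x (ι k) (binomial x k) (binomial x (suc k)) (binomial (1# + x) (suc k)) (binomial (1# + x) (suc (suc k)))))
      where
      k<N : k ℕ.< N
      k<N = ℕₚ.<-trans (ℕₚ.n<1+n k) k+1<N

    pascal : ∀ x {k} → k ℕ.< N → binomial (1# + x) (suc k) ≈ binomial x k + binomial x (suc k)
    pascal x {k} k<N = cancel-ι k<N (by-difference
      (+-cong (absorption x k<N) (sym (binomial-suc x k<N)))
      (solve 5 (λ x k b₀ b₁ c₁ →
         (con (+ 1) :+ k) :* c₁ :+ ((con (+ 1) :+ x) :* b₀ :+ (con (+ 1) :+ k) :* b₁) :=
         (con (+ 1) :+ k) :* (b₀ :+ b₁) :+ ((con (+ 1) :+ k) :* c₁ :+ b₀ :* (x :- k))) refl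
       x (ι k) (binomial x k) (binomial x (suc k)) (binomial (1# + x) (suc k))))

    binomial-shift : ∀ x {k} → k ℕ.≤ N →
      (1# + x - ι k) * binomial (1# + x) k ≈ (1# + x) * binomial x k
    binomial-shift x {zero} _ =
      solve 1 (λ x → (con (+ 1) :+ x :- con (+ 0)) :* con (+ 1) := (con (+ 1) :+ x) :* con (+ 1)) refl x
    binomial-shift x {suc k} k<N = by-difference
      (+-cong (*-congˡ {x - ι k} (pascal x k<N)) (sym (binomial-suc x k<N)))
      (solve 5 (λ x k b₀ b₁ c₁ →
         (con (+ 1) :+ x :- (con (+ 1) :+ k)) :* c₁
           :+ ((x :- k) :* (b₀ :+ b₁) :+ (con (+ 1) :+ k) :* b₁) :=
         (con (+ 1) :+ x) :* b₁ :+ ((x :- k) :* c₁ :+ b₀ :* (x :- k))) refl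
       x (ι k) (binomial x k) (binomial x (suc k)) (binomial (1# + x) (suc k)))

    binomial-0 : ∀ {k m} → m ℕ.< k → binomial (ι m) k ≈ 0#
    binomial-0 {suc k} {m} (s≤s m≤k) with ℕₚ.m≤n⇒m<n∨m≡n m≤k
    ... | inj₁ m<k = trans (*-congʳ (*-congʳ (binomial-0 m<k)))
            (solve 2 (λ a b → con (+ 0) :* a :* b := con (+ 0)) refl _ _)
    ... | inj₂ ≡.refl =
            solve 3 (λ b m v → b :* (m :- m) :* v := con (+ 0)) refl (binomial (ι m) m) (ι m) (ν m)

    binomial-self : ∀ {k} → k ℕ.≤ N → binomial (ι k) k ≈ 1#
    binomial-self {zero} _ = refl
    binomial-self {suc k} k<N = trans (pascal (ι k) k<N)
      (trans (+-cong (binomial-self (ℕₚ.<⇒≤ k<N)) (binomial-0 (ℕₚ.n<1+n k))) (+-identityʳ 1#))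

    alt : ℕ → Carrier
    alt = pow (- 1#)

    alt-even : ∀ k → alt (k ℕ.+ k) ≈ 1#
    alt-even zero = refl
    alt-even (suc k) rewrite ℕₚ.+-suc k k = trans (*-congʳ (*-congʳ (alt-even k)))
      (solve 0 (con (+ 1) :* (:- con (+ 1)) :* (:- con (+ 1)) := con (+ 1)) refl)

    binomial-−1 : ∀ k → k ℕ.≤ N → binomial (- 1#) k ≈ alt k
    binomial-−1 zero _ = refl
    binomial-−1 (suc k) k<N = by-difference
      (+-cong (*-congˡ {(- 1# - ι k) * ν k} (binomial-−1 k (ℕₚ.<⇒≤ k<N)))
              (*-congˡ { - alt k} (ν-inverse k<N)))
      (solve 4 (λ b k v a →
         b :* (:- con (+ 1) :- k) :* v
           :+ ((:- con (+ 1) :- k) :* v :* a :+ (:- a) :* con (+ 1)) :=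
         a :* (:- con (+ 1))
           :+ ((:- con (+ 1) :- k) :* v :* b :+ (:- a) :* ((con (+ 1) :+ k) :* v))) refl
       (binomial (- 1#) k) (ι k) (ν k) (alt k))

    -- The hypothesis says x ≡ y modulo p; a binomial coefficient with unit denominator respects
    -- this.
    ε-congruence : ∀ {x y} k → ε * x ≈ ε * y → ε * binomial x k ≈ ε * binomial y k
    ε-congruence zero _ = refl
    ε-congruence {x} {y} (suc k) εx≈εy = by-difference
      (+-cong (*-congˡ {(x - ι k) * ν k} (ε-congruence k εx≈εy))
              (*-congˡ {binomial y k * ν k} εx≈εy))
      (solve 7 (λ e x y k v b c →
         e :* (b :* (x :- k) :* v)
           :+ ((x :- k) :* v :* (e :* c) :+ c :* v :* (e :* y)) :=
         e :* (c :* (y :- k) :* v)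
           :+ ((x :- k) :* v :* (e :* b) :+ c :* v :* (e :* x))) refl
       ε x y (ι k) (ν k) (binomial x k) (binomial y k))

    ε-absorbs-ε : ∀ x y → ε * (x + ε * y) ≈ ε * x
    ε-absorbs-ε x y = by-difference (*-congˡ {y} ε²≈0)
      (solve 3 (λ e x y → e :* (x :+ e :* y) :+ y :* con (+ 0) := e :* x :+ y :* (e :* e)) refl ε x y)

    -- To first order each factor εt - j with j > 0 may be replaced by -j, which leaves εt (-1)^k
    -- k!/(k + 1)!.
    binomial-εt : ∀ t k → k ℕ.< N → binomial (ε * t) (suc k) ≈ ε * t * alt k * ν k
    binomial-εt t zero _ =
      solve 2 (λ x v → con (+ 1) :* (x :- con (+ 0)) :* v := x :* con (+ 1) :* v) refl (ε * t) (ν 0)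
    binomial-εt t (suc k) k+1<N = by-difference
      (+-cong (+-cong (*-congˡ {(ε * t - ι (suc k)) * ν (suc k)} (binomial-εt t k k<N))
                      (*-congˡ {t * t * alt k * ν k * ν (suc k)} ε²≈0))
              (*-congˡ { - (ε * t * alt k * ν (suc k))} (ν-inverse k<N)))
      (solve 7 (λ e t a k v w b →
         b :* (e :* t :- (con (+ 1) :+ k)) :* w
           :+ ((e :* t :- (con (+ 1) :+ k)) :* w :* (e :* t :* a :* v)
             :+ t :* t :* a :* v :* w :* con (+ 0)
             :+ (:- (e :* t :* a :* w)) :* con (+ 1)) :=
         e :* t :* (a :* (:- con (+ 1))) :* w
           :+ ((e :* t :- (con (+ 1) :+ k)) :* w :* b
             :+ t :* t :* a :* v :* w :* (e :* e)
             :+ (:- (e :* t :* a :* w)) :* ((con (+ 1) :+ k) :* v))) refl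
       ε t (alt k) (ι k) (ν k) (ν (suc k)) (binomial (ε * t) (suc k)))
      where
      k<N : k ℕ.< N
      k<N = ℕₚ.<-trans (ℕₚ.n<1+n k) k+1<N

    -- Truncated binomial series and Fermat's congruence.

    powerSum : Carrier → Carrier → ℕ → Carrier
    powerSum z x m = sum≤ m (λ k → binomial x k * pow z k)

    powerSum-cong : ∀ z {x y} m → x ≈ y → powerSum z x m ≈ powerSum z y m
    powerSum-cong z m x≈y = sum≤-cong m (λ k _ → *-congʳ (binomial-cong k x≈y))

    -- This is (1 + z)^(x+1) = (1 + z)(1 + z)^x for the truncated series; the extra term is the
    -- price of the truncation.
    powerSum-step : ∀ z x m → m ℕ.≤ N →
      powerSum z (1# + x) m + pow z (suc m) * binomial x m ≈ (1# + z) * powerSum z x m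
    powerSum-step z x zero _ =
      solve 1 (λ z → con (+ 1) :* con (+ 1) :+ con (+ 1) :* z :* con (+ 1) :=
        (con (+ 1) :+ z) :* (con (+ 1) :* con (+ 1))) refl z
    powerSum-step z x (suc m) m<N = by-difference
      (+-cong (powerSum-step z x m (ℕₚ.<⇒≤ m<N)) (*-congˡ {pow z m * z} (pascal x m<N)))
      (solve 7 (λ z s' s w c₁ b₀ b₁ →
         s' :+ c₁ :* (w :* z) :+ w :* z :* z :* b₁
           :+ ((con (+ 1) :+ z) :* s :+ w :* z :* (b₀ :+ b₁)) :=
         (con (+ 1) :+ z) :* (s :+ b₁ :* (w :* z))
           :+ (s' :+ w :* z :* b₀ :+ w :* z :* c₁)) refl
       z (powerSum z (1# + x) m) (powerSum z x m) (pow z m)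
       (binomial (1# + x) (suc m)) (binomial x m) (binomial x (suc m)))

    -- The truncated series of log(1 + z), hence the first-order coefficient of (1 + z)^(εt).
    σ : Carrier → ℕ → Carrier
    σ z zero = 0#
    σ z (suc k) = σ z k + alt k * ν k * pow z (suc k)

    powerSum-εt : ∀ z t m → m ℕ.≤ N → powerSum z (ε * t) m ≈ 1# + ε * t * σ z m
    powerSum-εt z t zero _ =
      solve 1 (λ x → con (+ 1) :* con (+ 1) := con (+ 1) :+ x :* con (+ 0)) refl (ε * t)
    powerSum-εt z t (suc m) m<N =
      trans (+-cong (powerSum-εt z t m (ℕₚ.<⇒≤ m<N)) (*-congʳ (binomial-εt t m m<N)))
        (solve 5 (λ x s a v w → con (+ 1) :+ x :* s :+ x :* a :* v :* w :=
                   con (+ 1) :+ x :* (s :+ a :* v :* w)) refl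
         (ε * t) (σ z m) (alt m) (ν m) (pow z (suc m)))

    powerSum-0 : ∀ z {x} → x ≈ 0# → powerSum z x N ≈ 1#
    powerSum-0 z x≈0 = trans
      (powerSum-cong z N (trans x≈0 (sym (zeroʳ ε))))
      (trans (powerSum-εt z 0# N ℕₚ.≤-refl)
        (solve 2 (λ e s → con (+ 1) :+ e :* con (+ 0) :* s := con (+ 1)) refl ε (σ z N)))

    powerSum-ι : ∀ z m → m ℕ.≤ N → powerSum z (ι m) N ≈ pow (1# + z) m
    powerSum-ι z zero _ = powerSum-0 z refl
    powerSum-ι z (suc m) m<N = by-difference
      (+-cong (powerSum-step z (ι m) N ℕₚ.≤-refl)
        (+-cong (*-congˡ {1# + z} (powerSum-ι z m (ℕₚ.<⇒≤ m<N)))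
                (*-congˡ { - pow z p} (binomial-0 m<N))))
      (solve 6 (λ s' s z w Z b →
         s' :+ ((con (+ 1) :+ z) :* s :+ ((con (+ 1) :+ z) :* w :+ (:- Z) :* con (+ 0))) :=
         w :* (con (+ 1) :+ z)
           :+ (s' :+ Z :* b :+ ((con (+ 1) :+ z) :* s :+ (:- Z) :* b))) refl
       (powerSum z (1# + ι m) N) (powerSum z (ι m) N) z (pow (1# + z) m) (pow z p) (binomial (ι m) N))

    -- At exponent p the truncation loses its first term, namely z^p.
    powerSum-p : ∀ z → powerSum z ε N + pow z p ≈ pow (1# + z) p
    powerSum-p z = by-difference
      (+-cong (powerSum-step z (ι N) N ℕₚ.≤-refl)
        (+-cong (*-congˡ {1# + z} (powerSum-ι z N ℕₚ.≤-refl))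
                (*-congˡ { - pow z p} (binomial-self {N} ℕₚ.≤-refl))))
      (solve 6 (λ s' s z w Z b →
         s' :+ Z :+ ((con (+ 1) :+ z) :* s :+ ((con (+ 1) :+ z) :* w :+ (:- Z) :* con (+ 1))) :=
         w :* (con (+ 1) :+ z)
           :+ (s' :+ Z :* b :+ ((con (+ 1) :+ z) :* s :+ (:- Z) :* b))) refl
       (powerSum z ε N) (powerSum z (ι N) N) z (pow (1# + z) N) (pow z p) (binomial (ι N) N))

    powerSum-p′ : ∀ z → powerSum z ε N ≈ 1# + ε * σ z N
    powerSum-p′ z = trans (powerSum-cong z N (sym (*-identityʳ ε)))
      (trans (powerSum-εt z 1# N ℕₚ.≤-refl) (+-congˡ (*-congʳ (*-identityʳ ε))))

    -- Evaluating powerSum z at p in two ways shows that ε kills (1 + z)^p - z^p - 1.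
    frobenius : ∀ z → ε * pow (1# + z) p ≈ ε + ε * pow z p
    frobenius z = by-difference
      (+-cong (*-congˡ { - ε} (powerSum-p z))
        (+-cong (*-congˡ {ε} (powerSum-p′ z)) (*-congˡ {σ z N} ε²≈0)))
      (solve 5 (λ e s W Z u →
         e :* W :+ ((:- e) :* W :+ (e :* (con (+ 1) :+ e :* u) :+ u :* con (+ 0))) :=
         e :+ e :* Z :+ ((:- e) :* (s :+ Z) :+ (e :* s :+ u :* (e :* e)))) refl
       ε (powerSum z ε N) (pow (1# + z) p) (pow z p) (σ z N))

    fermat : ∀ m → ε * pow (ι m) p ≈ ε * ι m
    fermat zero = *-congˡ (zeroʳ _)
    fermat (suc m) = trans (frobenius (ι m)) (trans (+-congˡ (fermat m))
      (solve 2 (λ e k → e :+ e :* k := e :* (con (+ 1) :+ k)) refl ε (ι m)))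

    -- The exponent `n-1 ℕ.+ n` is p - 2; s + 1 is cancelled twice from Fermat's congruence.
    fermat-inverse : ∀ {s} → s ℕ.< N → ε * pow (ι (suc s)) (n-1 ℕ.+ n) ≈ ε * ν s
    fermat-inverse {s} s<N = cancel-ι s<N (cancel-ι s<N (by-difference
      (+-cong (fermat (suc s)) (*-congˡ { - (ε * ι (suc s))} (ν-inverse s<N)))
      (solve 4 (λ e k w v →
         k :* (k :* (e :* w)) :+ (e :* k :+ (:- (e :* k)) :* con (+ 1)) :=
         k :* (k :* (e :* v)) :+ (e :* (w :* k :* k) :+ (:- (e :* k)) :* (k :* v))) refl
       ε (ι (suc s)) (pow (ι (suc s)) (n-1 ℕ.+ n)) (ν s))))

    ε-neg-pred : ε * ι N ≈ - ε
    ε-neg-pred = by-difference ε²≈0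
      (solve 1 (λ N → (con (+ 1) :+ N) :* N :+ con (+ 0) :=
        :- (con (+ 1) :+ N) :+ (con (+ 1) :+ N) :* (con (+ 1) :+ N)) refl (ι N))

    alt-pred-N : alt (n-1 ℕ.+ n) ≈ - 1#
    alt-pred-N = by-difference (-‿cong (alt-even n))
      (solve 1 (λ a → a :+ (:- con (+ 1)) := :- con (+ 1) :+ (:- (a :* (:- con (+ 1))))) refl _)

    -- Exactly one of the factors s + εt, s - 1 + εt, ... is εt. The induction moves the upper
    -- argument by `binomial-shift`; the base value is εt (-1)^(N-1)/N = εt, because N is even and
    -- εN = -ε.
    binomial-N : ∀ t s → s ℕ.< N → binomial (ι s + ε * t) N ≈ ε * t * ν s
    binomial-N t zero 0<N = cancel-ι {n-1 ℕ.+ n} ℕₚ.≤-refl (by-difference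
      (+-cong (+-cong (*-congˡ {ι N} (trans (binomial-cong N (+-identityˡ (ε * t)))
                        (binomial-εt t (n-1 ℕ.+ n) ℕₚ.≤-refl)))
                      (*-congˡ {ε * t * alt (n-1 ℕ.+ n)} (ν-inverse {n-1 ℕ.+ n} ℕₚ.≤-refl)))
              (+-cong (*-congˡ {ε * t} alt-pred-N)
                (+-cong (*-congˡ { - (t * ν 0)} ε-neg-pred) (*-congˡ {ε * t} (ν-inverse 0<N)))))
      (solve 7 (λ b e t a N v v₀ →
         N :* b :+ (N :* (e :* t :* a :* v) :+ e :* t :* a :* con (+ 1)
           :+ (e :* t :* (:- con (+ 1)) :+ ((:- (t :* v₀)) :* (:- e) :+ e :* t :* con (+ 1)))) :=
         N :* (e :* t :* v₀) :+ (N :* b :+ e :* t :* a :* (N :* v)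
           :+ (e :* t :* a :+ ((:- (t :* v₀)) :* (e :* N) :+ e :* t :* ((con (+ 1) :+ con (+ 0)) :* v₀))))) refl
       (binomial (0# + ε * t) N) ε t (alt (n-1 ℕ.+ n)) (ι N) (ν (n-1 ℕ.+ n)) (ν 0)))
    binomial-N t (suc s) s+1<N = cancel-ι s+1<N (by-difference
        (+-cong (+-cong shift (*-congˡ {1# - t} ε-kills))
          (+-cong (*-congˡ {1# + x} (binomial-N t s s<N))
            (+-cong (*-congˡ {ε * t} (ν-inverse s<N))
              (+-cong (*-congˡ {t * t * ν s} ε²≈0) (*-congˡ { - (ε * t)} (ν-inverse s+1<N))))))
        (solve 8 (λ b c s N t e v w →
           (con (+ 1) :+ (con (+ 1) :+ s)) :* c
             :+ ((con (+ 1) :+ (s :+ e :* t)) :* b :+ (con (+ 1) :- t) :* con (+ 0)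
             :+ ((con (+ 1) :+ (s :+ e :* t)) :* (e :* t :* v)
             :+ (e :* t :* con (+ 1) :+ (t :* t :* v :* con (+ 0) :+ (:- (e :* t)) :* con (+ 1))))) :=
           (con (+ 1) :+ (con (+ 1) :+ s)) :* (e :* t :* w)
             :+ (((con (+ 1) :+ (con (+ 1) :+ s)) :+ e :* t :- e) :* c :+ (con (+ 1) :- t) :* (e :* c)
             :+ ((con (+ 1) :+ (s :+ e :* t)) :* b
             :+ (e :* t :* ((con (+ 1) :+ s) :* v)
             :+ (t :* t :* v :* (e :* e)
                :+ (:- (e :* t)) :* ((con (+ 1) :+ (con (+ 1) :+ s)) :* w)))))) refl
         (binomial x N) c′ (ι s) (ι N) t ε (ν s) (ν (suc s))))
      where
      s<N : s ℕ.< N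
      s<N = ℕₚ.<-trans (ℕₚ.n<1+n s) s+1<N

      x c′ : Carrier
      x = ι s + ε * t
      c′ = binomial (ι (suc s) + ε * t) N

      shift : (ι (suc (suc s)) + ε * t - ε) * c′ ≈ (1# + x) * binomial x N
      shift = trans
        (*-cong (solve 3 (λ s y N → (con (+ 1) :+ (con (+ 1) :+ s)) :+ y :- (con (+ 1) :+ N) :=
                   con (+ 1) :+ (s :+ y) :- N) refl (ι s) (ε * t) (ι N))
                (binomial-cong N (+-assoc 1# (ι s) (ε * t))))
        (binomial-shift x ℕₚ.≤-refl)

      -- Multiplied by ε, the right side of `shift` vanishes, since it already contains ε, and the
      -- left side keeps only the unit s + 2. Hence the terms εt - ε in `shift` may be dropped.
      ε-kills : ε * c′ ≈ 0#
      ε-kills = cancel-ι s+1<N (by-difference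
        (+-cong (+-cong (*-congˡ {ε} shift) (*-congˡ {ε * (1# + x)} (binomial-N t s s<N)))
                (*-congˡ {(1# + x) * t * ν s + c′ - t * c′} ε²≈0))
        (solve 7 (λ b c s y e t v →
           (con (+ 1) :+ (con (+ 1) :+ s)) :* (e :* c)
             :+ (e :* ((con (+ 1) :+ (s :+ e :* t)) :* b)
               :+ e :* (con (+ 1) :+ (s :+ e :* t)) :* (e :* t :* v)
               :+ ((con (+ 1) :+ (s :+ e :* t)) :* t :* v :+ c :- t :* c) :* con (+ 0)) :=
           (con (+ 1) :+ (con (+ 1) :+ s)) :* con (+ 0)
             :+ (e :* (((con (+ 1) :+ (con (+ 1) :+ s)) :+ e :* t :- e) :* c)
               :+ e :* (con (+ 1) :+ (s :+ e :* t)) :* b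
               :+ ((con (+ 1) :+ (s :+ e :* t)) :* t :* v :+ c :- t :* c) :* (e :* e))) refl
         (binomial x N) c′ (ι s) (ε * t) ε t (ν s)))

    -- The sum T and its slope L.

    2# : Carrier
    2# = 1# + 1#

    T : Carrier → Carrier
    T x = powerSum (- 2#) x N

    T-cong : ∀ {x y} → x ≈ y → T x ≈ T y
    T-cong = powerSum-cong (- 2#) N

    alt-N : alt N ≈ 1#
    alt-N = alt-even n

    pow-1-2 : pow (1# - 2#) p ≈ - 1#
    pow-1-2 = trans (pow-cong p (solve 0 (con (+ 1) :- con (+ 2) := :- con (+ 1)) refl))
      (trans (*-congʳ alt-N) (*-identityˡ _))

    T-step : ∀ x → T (1# + x) + pow (- 2#) p * binomial x N ≈ - T x
    T-step x = trans (powerSum-step (- 2#) x N ℕₚ.≤-refl)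
      (solve 1 (λ y → (con (+ 1) :- con (+ 2)) :* y := :- y) refl (T x))

    -- `frobenius` at z = -2 already gives this, because (1 + z)^p = (-1)^p = -1.
    ε-pow-−2 : ε * pow (- 2#) p ≈ - (2# * ε)
    ε-pow-−2 = by-difference (+-cong (sym (frobenius (- 2#))) (*-congˡ {ε} pow-1-2))
      (solve 3 (λ e Z W → e :* Z :+ (e :* W :+ e :* (:- con (+ 1))) :=
        :- (con (+ 2) :* e) :+ (e :+ e :* Z :+ e :* W)) refl ε (pow (- 2#) p) (pow (1# - 2#) p))

    -- ε L s is the slope of t ↦ T (s + ε t).
    L : ℕ → Carrier
    L zero = σ (- 2#) N
    L (suc s) = 2# * ν s - L s

    T-expansion : ∀ t s → s ℕ.≤ N → T (ι s + ε * t) ≈ alt s + ε * t * L s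
    T-expansion t zero _ = trans (T-cong (+-identityˡ _)) (powerSum-εt (- 2#) t N ℕₚ.≤-refl)
    T-expansion t (suc s) s<N = trans (T-cong (+-assoc 1# (ι s) (ε * t))) (by-difference
      (+-cong (+-cong (T-step (ι s + ε * t)) (-‿cong (T-expansion t s (ℕₚ.<⇒≤ s<N))))
              (+-cong (*-congˡ { - pow (- 2#) p} (binomial-N t s s<N))
                      (*-congˡ { - (t * ν s)} ε-pow-−2)))
      (solve 9 (λ T' T₀ Z b e t v a l →
         T' :+ (:- T₀ :+ (:- (a :+ e :* t :* l))
           :+ ((:- Z) :* (e :* t :* v) :+ (:- (t :* v)) :* (:- (con (+ 2) :* e)))) :=
         a :* (:- con (+ 1)) :+ e :* t :* (con (+ 2) :* v :- l)
           :+ (T' :+ Z :* b :+ (:- T₀) :+ ((:- Z) :* b :+ (:- (t :* v)) :* (e :* Z)))) refl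
       (T (1# + (ι s + ε * t))) (T (ι s + ε * t)) (pow (- 2#) p) (binomial (ι s + ε * t) N)
       ε t (ν s) (alt s) (L s)))

    -- Both T(-1) and T(p) equal -1 - (-2)^p: the first by `T-step` at -1, where T(0) = C(-1, N) =
    -- 1, the second by `powerSum-p`. Since -1 = N - ε and p = 0 + ε, their expansions are 1 - εL(N)
    -- and 1 + εL(0).
    L-N : ε * L N ≈ - (ε * L 0)
    L-N = by-difference
      (+-cong (+-cong at-−1 (sym (T-step (- 1#))))
        (+-cong (+-cong (powerSum-0 (- 2#) (-‿inverseʳ 1#))
                   (*-congˡ {pow (- 2#) p} (trans (binomial-−1 N ℕₚ.≤-refl) alt-N)))
                (trans (+-congʳ (sym (powerSum-p′ (- 2#)))) (trans (powerSum-p (- 2#)) pow-1-2))))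
      (solve 7 (λ e l₀ l T₁ T₀ Z b →
         e :* l :+ (con (+ 1) :+ e :* (:- con (+ 1)) :* l :+ (T₀ :+ Z :* b)
           :+ (con (+ 1) :+ Z :* con (+ 1) :+ (:- con (+ 1)))) :=
         :- (e :* l₀) :+ (T₁ :+ (:- T₁)
           :+ (T₀ :+ Z :* b :+ (con (+ 1) :+ e :* l₀ :+ Z)))) refl
       ε (L 0) (L N) (T (- 1#)) (T (1# - 1#)) (pow (- 2#) p) (binomial (- 1#) N))
      where
      at-−1 : T (- 1#) ≈ 1# + ε * - 1# * L N
      at-−1 = trans
        (T-cong (solve 1 (λ N → :- con (+ 1) := N :+ (con (+ 1) :+ N) :* (:- con (+ 1))) refl (ι N)))
        (trans (T-expansion (- 1#) N ℕₚ.≤-refl) (+-congʳ alt-N))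

    -- The denominators s + 1 and j + 1 add up to p.
    ε-ν-complement : ∀ {s j} → s ℕ.+ suc j ≡ N → ε * ν s + ε * ν j ≈ 0#
    ε-ν-complement {s} {j} s+j+1≡N = by-difference
      (+-cong (+-cong (*-congˡ {ε * ν s} (sym (ν-inverse j<N))) (*-congˡ {ε * ν j} (sym (ν-inverse s<N))))
              (+-cong (*-congˡ {ε * ν s * ν j} sum) (*-congˡ {ν s * ν j} ε²≈0)))
      (solve 5 (λ e s j v w →
         e :* v :+ e :* w :+ (e :* v :* ((con (+ 1) :+ j) :* w) :+ e :* w :* ((con (+ 1) :+ s) :* v)
           :+ (e :* v :* w :* e :+ v :* w :* con (+ 0))) :=
         con (+ 0) :+ (e :* v :* con (+ 1) :+ e :* w :* con (+ 1)
           :+ (e :* v :* w :* (con (+ 1) :+ (s :+ (con (+ 1) :+ j))) :+ v :* w :* (e :* e)))) refl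
       ε (ι s) (ι j) (ν s) (ν j))
      where
      s<N : s ℕ.< N
      s<N = ≡.subst (s ℕ.<_) s+j+1≡N (ℕₚ.m<m+n s (s≤s z≤n))
      j<N : j ℕ.< N
      j<N = ≡.subst (j ℕ.<_) s+j+1≡N (ℕₚ.m≤n+m (suc j) s)
      sum : 1# + (ι s + ι (suc j)) ≈ ε
      sum = +-congˡ (trans (sym (ι-+ s (suc j))) (reflexive (≡.cong ι s+j+1≡N)))

    L-antisymmetric : ∀ s j → s ℕ.+ j ≡ N → ε * L j ≈ - (ε * L s)
    L-antisymmetric zero j ≡.refl = L-N
    L-antisymmetric (suc s) j s+1+j≡N = by-difference
      (+-cong (-‿cong (L-antisymmetric s (suc j) s+j+1≡N)) (*-congˡ {2#} (ε-ν-complement s+j+1≡N)))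
      (solve 5 (λ e v w l m →
         e :* m :+ (:- (:- (e :* l)) :+ con (+ 2) :* con (+ 0)) :=
         :- (e :* (con (+ 2) :* v :- l)) :+ (:- (e :* (con (+ 2) :* w :- m)) :+ con (+ 2) :* (e :* v :+ e :* w))) refl
       ε (ν s) (ν j) (L s) (L j))
      where
      s+j+1≡N : s ℕ.+ suc j ≡ N
      s+j+1≡N = ≡.trans (ℕₚ.+-suc s j) s+1+j≡N

    -- The sum S: telescoping recurrence and expansion.

    ι-double : ∀ k → ι (k ℕ.+ k) ≈ ι k + ι k
    ι-double k = ι-+ k k

    double<N : ∀ {k} → k ℕ.< n → suc (k ℕ.+ k) ℕ.< N
    double<N {k} k<n = ≡.subst (ℕ._≤ N) (ℕₚ.+-suc (suc k) k) (ℕₚ.+-mono-≤ k<n k<n)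

    ν-double : ∀ {k} → k ℕ.< n → ν k ≈ 2# * ν (suc (k ℕ.+ k))
    ν-double {k} k<n = cancel-ι {k} (ℕₚ.<-≤-trans k<n (ℕₚ.m≤m+n n n)) (by-difference
      (+-cong (+-cong (ν-inverse {k} (ℕₚ.<-≤-trans k<n (ℕₚ.m≤m+n n n)))
                      (sym (ν-inverse (double<N k<n))))
              (*-congˡ {ν (suc (k ℕ.+ k))} (ι-double k)))
      (solve 4 (λ k d v w →
         (con (+ 1) :+ k) :* v :+ (con (+ 1) :+ (con (+ 1) :+ (con (+ 1) :+ d)) :* w :+ w :* (k :+ k)) :=
         (con (+ 1) :+ k) :* (con (+ 2) :* w) :+ ((con (+ 1) :+ k) :* v :+ con (+ 1) :+ w :* d)) refl
       (ι k) (ι (k ℕ.+ k)) (ν k) (ν (suc (k ℕ.+ k)))))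

    -- The reciprocal of 2k - 1; the index is shifted because `ν j` inverts j + 1.
    o : ℕ → Carrier
    o zero = - 1#
    o (suc k) = ν (k ℕ.+ k)

    o-inverse : ∀ k → k ℕ.≤ n → (ι k + ι k - 1#) * o k ≈ 1#
    o-inverse zero _ = solve 0 ((con (+ 0) :+ con (+ 0) :- con (+ 1)) :* (:- con (+ 1)) := con (+ 1)) refl
    o-inverse (suc k) k<n = by-difference
      (+-cong (ν-inverse (ℕₚ.<-trans (ℕₚ.n<1+n _) (double<N k<n))) (*-congˡ { - ν (k ℕ.+ k)} (ι-double k)))
      (solve 3 (λ k d v →
         ((con (+ 1) :+ k) :+ (con (+ 1) :+ k) :- con (+ 1)) :* v :+ (con (+ 1) :+ (:- v) :* (k :+ k)) :=
         con (+ 1) :+ ((con (+ 1) :+ d) :* v :+ (:- v) :* d)) refl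
       (ι k) (ι (k ℕ.+ k)) (ν (k ℕ.+ k)))

    term : Carrier → ℕ → Carrier
    term x k = binomial x k * binomial (- 1# - x) k * o k

    S : Carrier → ℕ → Carrier
    S x m = sum≤ m (term x)

    S-cong : ∀ {x y} m → x ≈ y → S x m ≈ S y m
    S-cong m x≈y = sum≤-cong m (λ k _ →
      *-congʳ (*-cong (binomial-cong k x≈y) (binomial-cong k (+-congˡ (-‿cong x≈y)))))

    S-reflection : ∀ x m → S x m ≈ S (- 1# - x) m
    S-reflection x m = sum≤-cong m (λ k _ → *-congʳ (trans (*-comm _ _)
      (*-congˡ (binomial-cong k
        (solve 1 (λ x → x := :- con (+ 1) :- (:- con (+ 1) :- x)) refl x)))))

    A : Carrier → Carrier
    A x = 2# * x + 1#

    w : Carrier → ℕ → Carrier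
    w x m = binomial x m * binomial (- 2# - x) m

    -- A telescoping pair in the sense of Wilf and Zeilberger, with companion 2w. Multiplied by (m +
    -- 1)², every binomial coefficient becomes a polynomial multiple of C(x, m) or C(-2 - x, m), and
    -- what remains is an identity modulo (2m + 1) o(m + 1) = 1.
    term-step : ∀ x m → m ℕ.< n →
      A x * term (1# + x) (suc m) ≈
      (A x + 2#) * term x (suc m) + 2# * (w x (suc m) - w x m)
    term-step x m m<n = cancel-ι m<N (cancel-ι m<N (by-difference
      (+-cong (+-cong (*-congˡ {A x * o (suc m)} (*-cong (absorption x m<N) second))
                      (*-congˡ { - ((A x + 2#) * o (suc m))} (*-cong (binomial-suc x m<N) third)))
              (+-cong (*-congˡ { - 2#} (*-cong (binomial-suc x m<N) (binomial-suc y m<N)))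
                      (*-congˡ { - (2# * (1# + x) * (1# + x) * b * d)} (o-inverse (suc m) m<n))))
      (solve 10 (λ x m o b b₁ c₁ d d₁ f₁ f →
         let k = con (+ 1) :+ m ; y = :- con (+ 2) :- x ; a = con (+ 2) :* x :+ con (+ 1) in
         k :* (k :* (a :* (c₁ :* f :* o)))
           :+ (a :* o :* ((con (+ 1) :+ x) :* b :* (d :* (y :- m)))
             :+ (:- ((a :+ con (+ 2)) :* o)) :* (b :* (x :- m) :* ((con (+ 1) :+ y) :* d))
             :+ ((:- con (+ 2)) :* (b :* (x :- m) :* (d :* (y :- m)))
               :+ (:- (con (+ 2) :* (con (+ 1) :+ x) :* (con (+ 1) :+ x) :* b :* d)) :* con (+ 1))) :=
         k :* (k :* ((a :+ con (+ 2)) :* (b₁ :* f₁ :* o) :+ con (+ 2) :* (b₁ :* d₁ :- b :* d)))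
           :+ (a :* o :* (k :* c₁ :* (k :* f))
             :+ (:- ((a :+ con (+ 2)) :* o)) :* (k :* b₁ :* (k :* f₁))
             :+ ((:- con (+ 2)) :* (k :* b₁ :* (k :* d₁))
               :+ (:- (con (+ 2) :* (con (+ 1) :+ x) :* (con (+ 1) :+ x) :* b :* d)) :* ((k :+ k :- con (+ 1)) :* o)))) refl
       x (ι m) (o (suc m)) b (binomial x (suc m)) (binomial (1# + x) (suc m))
       d (binomial y (suc m)) (binomial (- 1# - x) (suc m)) (binomial (- 1# - (1# + x)) (suc m)))))
      where
      m<N : m ℕ.< N
      m<N = ℕₚ.<-≤-trans m<n (ℕₚ.m≤m+n n n)
      y b d : Carrier
      y = - 2# - x
      b = binomial x m
      d = binomial y m
      second : ι (suc m) * binomial (- 1# - (1# + x)) (suc m) ≈ d * (y - ι m)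
      second = trans (*-congˡ (binomial-cong (suc m)
          (solve 1 (λ x → :- con (+ 1) :- (con (+ 1) :+ x) := :- con (+ 2) :- x) refl x)))
        (binomial-suc y m<N)
      third : ι (suc m) * binomial (- 1# - x) (suc m) ≈ (1# + y) * d
      third = trans (*-congˡ (binomial-cong (suc m)
          (solve 1 (λ x → :- con (+ 1) :- x := con (+ 1) :+ (:- con (+ 2) :- x)) refl x)))
        (absorption y m<N)

    S-step : ∀ x m → m ℕ.≤ n → A x * S (1# + x) m ≈ (A x + 2#) * S x m + 2# * w x m
    S-step x zero _ = solve 1 (λ a → a :* (con (+ 1) :* con (+ 1) :* (:- con (+ 1))) :=
      (a :+ con (+ 2)) :* (con (+ 1) :* con (+ 1) :* (:- con (+ 1))) :+ con (+ 2) :* (con (+ 1) :* con (+ 1))) refl (A x)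
    S-step x (suc m) m<n = by-difference (+-cong (S-step x m (ℕₚ.<⇒≤ m<n)) (term-step x m m<n))
      (solve 7 (λ a s s' u u' w₀ w₁ →
         a :* (s' :+ u') :+ ((a :+ con (+ 2)) :* s :+ con (+ 2) :* w₀
           :+ ((a :+ con (+ 2)) :* u :+ con (+ 2) :* (w₁ :- w₀))) :=
         (a :+ con (+ 2)) :* (s :+ u) :+ con (+ 2) :* w₁ :+ (a :* s' :+ a :* u')) refl
       (A x) (S x m) (S (1# + x) m) (term x (suc m)) (term (1# + x) (suc m)) (w x m) (w x (suc m)))

    binomial-−2 : ∀ m → m ℕ.≤ N → binomial (- 2#) m ≈ alt m * ι (suc m)
    binomial-−2 zero _ = solve 0 (con (+ 1) := con (+ 1) :* (con (+ 1) :+ con (+ 0))) refl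
    binomial-−2 (suc m) m<N = by-difference
      (+-cong (*-congˡ {(- 2# - ι m) * ν m} (binomial-−2 m (ℕₚ.<⇒≤ m<N)))
              (*-congˡ {alt m * (- 2# - ι m)} (ν-inverse m<N)))
      (solve 4 (λ b m v a →
         b :* (:- con (+ 2) :- m) :* v
           :+ ((:- con (+ 2) :- m) :* v :* (a :* (con (+ 1) :+ m)) :+ a :* (:- con (+ 2) :- m) :* con (+ 1)) :=
         a :* (:- con (+ 1)) :* (con (+ 1) :+ (con (+ 1) :+ m))
           :+ ((:- con (+ 2) :- m) :* v :* b :+ a :* (:- con (+ 2) :- m) :* ((con (+ 1) :+ m) :* v))) refl
       (binomial (- 2#) m) (ι m) (ν m) (alt m))

    alt-square : ∀ k → alt k * alt k ≈ 1#
    alt-square zero = *-identityˡ 1#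
    alt-square (suc k) = trans
      (solve 1 (λ a → a :* (:- con (+ 1)) :* (a :* (:- con (+ 1))) := a :* a) refl (alt k)) (alt-square k)

    -- Multiplying the hypothesis by ε gives u ε z = 0, hence εz = 0; so the perturbation εy of the
    -- unit u has no effect on z.
    ε-unit : ∀ {u u⁻¹ y z v} → u * u⁻¹ ≈ 1# → (u + ε * y) * z ≈ ε * v → u * z ≈ ε * v
    ε-unit {u} {u⁻¹} {y} {z} {v} uu⁻¹≈1 h = by-difference (+-cong h (*-congˡ { - y} εz≈0))
      (solve 5 (λ u e y z v →
         u :* z :+ (e :* v :+ (:- y) :* con (+ 0)) :=
         e :* v :+ ((u :+ e :* y) :* z :+ (:- y) :* (e :* z))) refl u ε y z v)
      where
      εz≈0 : ε * z ≈ 0#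
      εz≈0 = cancel-unit uu⁻¹≈1 (by-difference (+-cong (*-congˡ {ε} h) (*-congˡ {v - y * z} ε²≈0))
        (solve 5 (λ u e y z v →
           u :* (e :* z) :+ (e :* (e :* v) :+ (v :- y :* z) :* con (+ 0)) :=
           u :* con (+ 0) :+ (e :* ((u :+ e :* y) :* z) :+ (v :- y :* z) :* (e :* e))) refl u ε y z v))

    ε-double : ε * ι n + ε * ι n ≈ - ε
    ε-double = trans (sym (distribˡ ε (ι n) (ι n))) (trans (*-congˡ (sym (ι-double n))) ε-neg-pred)

    -- Shifting both binomials and doubling gives (2x + 3 - ε)(x + 2) w(x + 1) = (x + 1)(2x + 3 + ε)
    -- w(x), since 2n = ε - 1. As w(x) is a multiple of ε, the factors 2r + 3 cancel and εt/(r + 1)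
    -- becomes εt/(r + 2). At r = 0 the value is -εt(n + 1)/n, which is εt because 2n ≡ -1 modulo p.
    w-expansion : ∀ t r → r ℕ.< n → w (ι r + ε * t) n ≈ ε * t * ν r
    w-expansion t zero 0<n = trans
        (*-cong (trans (binomial-cong n (+-identityˡ (ε * t))) (binomial-εt t n-1 n-1<N))
                (binomial-cong n (+-congˡ (-‿cong (+-identityˡ (ε * t))))))
        (cancel-ι n-1<N (by-difference
          (+-cong (+-cong (*-congˡ {ι n * t * a * v} (trans (ε-congruence n (trans (*-congˡ
                        (solve 2 (λ e t → :- con (+ 2) :- e :* t := :- con (+ 2) :+ e :* (:- t)) refl ε t))
                        (ε-absorbs-ε (- 2#) (- t))))
                      (*-congˡ {ε} (binomial-−2 n (ℕₚ.m≤m+n n n)))))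
                    (*-congˡ { - (ε * t * ι (suc n) * ι n * v)} (alt-square n-1)))
            (+-cong (*-congˡ { - (ε * t * ι (suc n))} (ν-inverse n-1<N))
              (+-cong (*-congˡ { - t} ε-double) (*-congˡ { - (ε * t * ι n)} (ν-inverse {0} (s≤s z≤n))))))
          (solve 8 (λ e t a v b k j v₀ →
             let k = con (+ 1) :+ j in
             k :* (e :* t :* a :* v :* b)
               :+ (k :* t :* a :* v :* (e :* (a :* (:- con (+ 1)) :* (con (+ 1) :+ k)))
                 :+ (:- (e :* t :* (con (+ 1) :+ k) :* k :* v)) :* con (+ 1)
                 :+ ((:- (e :* t :* (con (+ 1) :+ k))) :* con (+ 1)
                   :+ ((:- t) :* (:- e) :+ (:- (e :* t :* k)) :* con (+ 1)))) :=
             k :* (e :* t :* v₀)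
               :+ (k :* t :* a :* v :* (e :* b)
                 :+ (:- (e :* t :* (con (+ 1) :+ k) :* k :* v)) :* (a :* a)
                 :+ ((:- (e :* t :* (con (+ 1) :+ k))) :* (k :* v)
                   :+ ((:- t) :* (e :* k :+ e :* k) :+ (:- (e :* t :* k)) :* ((con (+ 1) :+ con (+ 0)) :* v₀))))) refl
           ε t a v (binomial (- 2# - ε * t) n) (ι n) (ι n-1) (ν 0))))
      where
      n-1<N : n-1 ℕ.< N
      n-1<N = ℕₚ.m≤m+n n n
      a v : Carrier
      a = alt n-1
      v = ν n-1
    w-expansion t (suc r) r+1<n =
      cancel-ι r+1<N (cancel-ι 2r+2<N (by-difference
        (+-cong (+-cong reduced (*-congˡ {ι (suc (suc r)) * w (ι (suc r) + ε * t) n - ε * t} (ι-double (suc r))))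
                (*-congˡ { - (ε * t * ι (suc 2r+2))} (ν-inverse r+1<N)))
        (solve 6 (λ e t r d w v →
           let q = con (+ 1) :+ (con (+ 1) :+ r) ; h = (con (+ 1) :+ r) :+ (con (+ 1) :+ r) in
           (con (+ 1) :+ d) :* (q :* w)
             :+ (e :* (t :* (con (+ 1) :+ h)) :+ (q :* w :- e :* t) :* h :+ (:- (e :* t :* (con (+ 1) :+ d))) :* con (+ 1)) :=
           (con (+ 1) :+ d) :* (q :* (e :* t :* v))
             :+ ((con (+ 1) :+ h) :* q :* w :+ (q :* w :- e :* t) :* d :+ (:- (e :* t :* (con (+ 1) :+ d))) :* (q :* v))) refl
         ε t (ι r) (ι 2r+2) (w (ι (suc r) + ε * t) n) (ν (suc r)))))
      where
      2r+2 : ℕ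
      2r+2 = suc r ℕ.+ suc r
      r<n : r ℕ.< n
      r<n = ℕₚ.<-trans (ℕₚ.n<1+n r) r+1<n
      r+1<N : suc r ℕ.< N
      r+1<N = ℕₚ.<-≤-trans r+1<n (ℕₚ.m≤m+n n n)
      2r+2<N : 2r+2 ℕ.< N
      2r+2<N = ℕₚ.+-mono-< r+1<n r+1<n
      u q x y′ C′ D′ b D : Carrier
      u = 1# + (ι (suc r) + ι (suc r))
      q = ι (suc (suc r))
      x = ι r + ε * t
      y′ = - 2# - (1# + x)
      C′ = binomial (1# + x) n
      D′ = binomial y′ n
      b = binomial x n
      D = binomial (- 2# - x) n
      shift : (1# + y′ - ι n) * D ≈ (1# + y′) * D′
      shift = trans
        (*-congˡ (binomial-cong n (solve 1 (λ x → :- con (+ 2) :- x :=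
          con (+ 1) :+ (:- con (+ 2) :- (con (+ 1) :+ x))) refl x)))
        (binomial-shift y′ (ℕₚ.m≤m+n n n))
      uq-inverse : u * q * (ν 2r+2 * ν (suc r)) ≈ 1#
      uq-inverse = by-difference
        (+-cong (*-cong (ν-inverse 2r+2<N) (ν-inverse r+1<N))
                (*-congˡ { - (q * (ν 2r+2 * ν (suc r)))} (ι-double (suc r))))
        (solve 5 (λ r d q v w →
           let h = r :+ r in
           (con (+ 1) :+ h) :* q :* (v :* w) :+ (con (+ 1) :* con (+ 1) :+ (:- (q :* (v :* w))) :* h) :=
           con (+ 1) :+ ((con (+ 1) :+ d) :* v :* (q :* w) :+ (:- (q :* (v :* w))) :* d)) refl
         (ι (suc r)) (ι 2r+2) q (ν 2r+2) (ν (suc r)))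
      reduced : u * q * w (ι (suc r) + ε * t) n ≈ ε * (t * u)
      -- With u = 2r + 3 and q = r + 2, this `y` is the ε-part of (2x + 3 - ε)(x + 2) = (u + ε(2t -
      -- 1))(q + εt).
      reduced = ε-unit {y = (2# * t - 1#) * q + u * t + ε * ((2# * t - 1#) * t)} uq-inverse
        (trans (*-congˡ (*-cong (binomial-cong n (+-assoc 1# (ι r) (ε * t)))
                                (binomial-cong n (+-congˡ (-‿cong (+-assoc 1# (ι r) (ε * t)))))))
        (by-difference
          (+-cong (+-cong (*-congˡ { - 2#} (*-cong (binomial-shift x (ℕₚ.m≤m+n n n)) (sym shift)))
                          (*-congˡ {(2# + x) * (C′ * D′) + (1# + x) * (b * D)} (sym (ι-double n))))
            (+-cong (*-congˡ {(1# + x) * (1# + 2# + 2# * x + ε)} (w-expansion t r r<n))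
              (+-cong (*-congˡ {ε * t * u} (ν-inverse (ℕₚ.<-trans (ℕₚ.n<1+n r) r+1<N)))
                      (*-congˡ {(ι (suc r) * (2# * t + 1#) + t * u + ε * (t * (2# * t + 1#))) * (t * ν r)} ε²≈0))))
          (solve 9 (λ t r n N v c' d' b d →
             let e = con (+ 1) :+ N
                 k = con (+ 1) :+ r
                 u = con (+ 1) :+ (k :+ k)
                 q = con (+ 1) :+ k
                 x = r :+ e :* t
                 y = :- con (+ 2) :- (con (+ 1) :+ x)
                 t₁ = con (+ 2) :* t :- con (+ 1)
                 t₂ = con (+ 2) :* t :+ con (+ 1)
                 c₁ = (con (+ 2) :+ x) :* (c' :* d') :+ (con (+ 1) :+ x) :* (b :* d)
                 c₂ = (con (+ 1) :+ x) :* (con (+ 1) :+ con (+ 2) :+ con (+ 2) :* x :+ e)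
                 c₃ = (k :* t₂ :+ t :* u :+ e :* (t :* t₂)) :* (t :* v)
             in
             (u :* q :+ e :* (t₁ :* q :+ u :* t :+ e :* (t₁ :* t))) :* (c' :* d')
               :+ ((:- con (+ 2)) :* ((con (+ 1) :+ x) :* b :* ((con (+ 1) :+ y :- n) :* d))
                 :+ c₁ :* N :+ (c₂ :* (e :* t :* v) :+ (e :* t :* u :* con (+ 1) :+ c₃ :* con (+ 0)))) :=
             e :* (t :* u)
               :+ ((:- con (+ 2)) :* ((con (+ 1) :+ x :- n) :* c' :* ((con (+ 1) :+ y) :* d'))
                 :+ c₁ :* (n :+ n) :+ (c₂ :* (b :* d) :+ (e :* t :* u :* (k :* v) :+ c₃ :* (e :* e))))) refl
           t (ι r) (ι n) (ι N) (ν r) C′ D′ b D)))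

    -- Partial fractions: the summand at k = m + 1 is -εt/((m + 1)(2m + 1)) = εt(2/(2m + 2) - 2/(2m
    -- + 1)), and the last bracket is L(2m + 2) - L(2m). This is how L enters the left-hand sum.
    S-εt : ∀ t m → m ℕ.≤ n → S (ε * t) m ≈ ε * t * (L (m ℕ.+ m) - L 0) - 1#
    S-εt t zero _ = solve 2 (λ y l → con (+ 1) :* con (+ 1) :* (:- con (+ 1)) :=
      y :* (l :- l) :- con (+ 1)) refl (ε * t) (L 0)
    S-εt t (suc m) m<n = trans
      (+-cong (S-εt t m (ℕₚ.<⇒≤ m<n))
        (trans (*-congʳ (*-congʳ (binomial-εt t m m<N))) term-εt))
      (trans (solve 5 (λ e t l l₀ d → e :* t :* (l :- l₀) :- con (+ 1) :+ e :* t :* d :=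
                e :* t :* (l :+ d :- l₀) :- con (+ 1)) refl ε t (L (m ℕ.+ m)) (L 0) (2# * ν (suc (m ℕ.+ m)) - 2# * ν (m ℕ.+ m)))
        (+-congʳ (*-congˡ (+-congʳ
          (trans (solve 3 (λ l v v' → l :+ (con (+ 2) :* v' :- con (+ 2) :* v) :=
                    con (+ 2) :* v' :- (con (+ 2) :* v :- l)) refl _ _ _)
            (reflexive (≡.cong (λ j → L (suc j)) (≡.sym (ℕₚ.+-suc m m)))))))))
      where
      m<N : m ℕ.< N
      m<N = ℕₚ.<-≤-trans m<n (ℕₚ.m≤m+n n n)
      term-εt : ε * t * alt m * ν m * binomial (- 1# - ε * t) (suc m) * ν (m ℕ.+ m) ≈
                ε * t * (2# * ν (suc (m ℕ.+ m)) - 2# * ν (m ℕ.+ m))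
      term-εt = by-difference
        (+-cong (+-cong (*-congˡ {t * alt m * ν m * ν (m ℕ.+ m)}
                          (trans (ε-congruence (suc m) (trans (*-congˡ
                              (solve 2 (λ e t → :- con (+ 1) :- e :* t := :- con (+ 1) :+ e :* (:- t)) refl ε t))
                            (ε-absorbs-ε (- 1#) (- t))))
                            (*-congˡ {ε} (binomial-−1 (suc m) m<N))))
                        (*-congˡ { - (ε * t * ν m * ν (m ℕ.+ m))} (alt-square m)))
          (+-cong (*-congˡ { - (ε * t * ν (m ℕ.+ m))} (ν-double m<n))
            (+-cong (*-congˡ {2# * ε * t * ν (suc (m ℕ.+ m))} (ν-inverse (ℕₚ.<-trans (ℕₚ.n<1+n _) (double<N m<n))))
                    (*-congˡ { - (2# * ε * t * ν (m ℕ.+ m))} (ν-inverse (double<N m<n))))))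
        (solve 8 (λ e t a v b v₀ v₁ d →
           e :* t :* a :* v :* b :* v₀
             :+ (t :* a :* v :* v₀ :* (e :* (a :* (:- con (+ 1)))) :+ (:- (e :* t :* v :* v₀)) :* con (+ 1)
               :+ ((:- (e :* t :* v₀)) :* (con (+ 2) :* v₁)
                 :+ (con (+ 2) :* e :* t :* v₁ :* con (+ 1)
                   :+ (:- (con (+ 2) :* e :* t :* v₀)) :* con (+ 1)))) :=
           e :* t :* (con (+ 2) :* v₁ :- con (+ 2) :* v₀)
             :+ (t :* a :* v :* v₀ :* (e :* b) :+ (:- (e :* t :* v :* v₀)) :* (a :* a)
               :+ ((:- (e :* t :* v₀)) :* v
                 :+ (con (+ 2) :* e :* t :* v₁ :* ((con (+ 1) :+ d) :* v₀)
                   :+ (:- (con (+ 2) :* e :* t :* v₀)) :* ((con (+ 1) :+ (con (+ 1) :+ d)) :* v₁))))) refl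
         ε t (alt m) (ν m) (binomial (- 1# - ε * t) (suc m)) (ν (m ℕ.+ m)) (ν (suc (m ℕ.+ m))) (ι (m ℕ.+ m)))

    S-expansion : ∀ t r → r ℕ.≤ n →
      S (ι r + ε * t) n ≈ 2# * ε * t - A (ι r + ε * t) * (1# + 2# * ε * t * L (r ℕ.+ r))
    S-expansion t zero _ = trans (S-cong n (+-identityˡ (ε * t))) (trans (S-εt t n ℕₚ.≤-refl) (by-difference
      (+-cong (*-congˡ {t} L-N) (*-congˡ {2# * 2# * t * t * L 0} ε²≈0))
      (solve 4 (λ e t l l₀ →
         e :* t :* (l :- l₀) :- con (+ 1)
           :+ (t :* (:- (e :* l₀)) :+ con (+ 2) :* con (+ 2) :* t :* t :* l₀ :* con (+ 0)) :=
         con (+ 2) :* e :* t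
           :- (con (+ 2) :* (con (+ 0) :+ e :* t) :+ con (+ 1)) :* (con (+ 1) :+ con (+ 2) :* e :* t :* l₀)
           :+ (t :* (e :* l) :+ con (+ 2) :* con (+ 2) :* t :* t :* l₀ :* (e :* e))) refl
       ε t (L N) (L 0))))
    S-expansion t (suc r) r<n = trans (S-cong n to-sum) (trans (cancel-A at-1+x)
        (+-congˡ (-‿cong (*-cong (+-congʳ (*-congˡ (sym to-sum)))
          (+-congˡ (*-congˡ (reflexive (≡.cong (λ j → L (suc j)) (≡.sym (ℕₚ.+-suc r r))))))))))
      where
      x u M v₀ v₁ : Carrier
      x = ι r + ε * t
      u = 1# + (ι r + ι r)
      -- Chosen so that A(x) A(1 + x) = u(u + 2) + εM, where u = 2r + 1 and A(x) = u + 2εt; it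
      -- enters the cofactor of ε² below.
      M = 2# * 2# * t * (u + 1#) + 2# * 2# * ε * t * t
      v₀ = ν (r ℕ.+ r)
      v₁ = ν (suc (r ℕ.+ r))
      u-inverse : u * v₀ ≈ 1#
      u-inverse = trans (*-congʳ (+-congˡ (sym (ι-double r))))
        (ν-inverse (ℕₚ.<-trans (ℕₚ.n<1+n _) (double<N r<n)))
      u+1-inverse : (u + 1#) * v₁ ≈ 1#
      u+1-inverse = trans
        (*-congʳ (trans (+-comm u 1#) (+-congˡ (+-congˡ (sym (ι-double r))))))
        (ν-inverse (double<N r<n))
      -- A(x) differs from the unit 2r + 1 by a multiple of ε, so `ε-unit` with right-hand side 0
      -- allows the cancellation.
      cancel-A : ∀ {y z} → A x * y ≈ A x * z → y ≈ z
      cancel-A {y} {z} Ay≈Az = trans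
        (solve 2 (λ y z → y := z :+ (y :- z)) refl y z)
        (trans (+-congˡ (cancel-unit u-inverse (trans
          (ε-unit {v = 0#} u-inverse (by-difference Ay≈Az
            (solve 5 (λ e r t y z →
               let a = con (+ 2) :* (r :+ e :* t) :+ con (+ 1) in
               (con (+ 1) :+ (r :+ r) :+ e :* (con (+ 2) :* t)) :* (y :- z) :+ a :* z :=
               e :* con (+ 0) :+ a :* y) refl ε (ι r) t y z)))
          (trans (zeroʳ ε) (sym (zeroʳ u)))))) (+-identityʳ z))
      to-sum : ι (suc r) + ε * t ≈ 1# + x
      to-sum = +-assoc 1# (ι r) (ε * t)
      -- Once common terms are removed, the claim is εt times 4 + 2/(r + 1) + 4u(u + 2)(1/(u + 1) -
      -- 1/u) = 0, which holds because r + 1 = (u + 1)/2.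
      at-1+x : A x * S (1# + x) n ≈
        A x * (2# * ε * t - A (1# + x) * (1# + 2# * ε * t * L (suc (suc (r ℕ.+ r)))))
      at-1+x = by-difference
        (+-cong (+-cong (S-step x n ℕₚ.≤-refl)
                        (+-cong (*-congˡ {A x + 2#} (S-expansion t r (ℕₚ.<⇒≤ r<n)))
                                (*-congˡ {2#} (w-expansion t r r<n))))
          (+-cong (+-cong (*-congˡ {2# * 2# * t * (v₁ - v₀) * M} ε²≈0)
                          (*-congˡ { - (2# * 2# * ε * t * (u + 2#))} u-inverse))
            (+-cong (*-congˡ {2# * 2# * ε * t * (u + 1#)} u+1-inverse)
                    (*-congˡ {2# * ε * t} (ν-double r<n)))))
        (solve 10 (λ e t r v v₀ v₁ l s' s w →
           let u = con (+ 1) :+ (r :+ r)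
               x = r :+ e :* t
               a = con (+ 2) :* x :+ con (+ 1)
               a' = con (+ 2) :* (con (+ 1) :+ x) :+ con (+ 1)
               l' = con (+ 2) :* v₁ :- (con (+ 2) :* v₀ :- l)
               m = con (+ 2) :* con (+ 2) :* t :* (u :+ con (+ 1)) :+ con (+ 2) :* con (+ 2) :* e :* t :* t
               et = con (+ 2) :* e :* t
               et₂ = con (+ 2) :* con (+ 2) :* e :* t
           in
           a :* s' :+ ((a :+ con (+ 2)) :* s :+ con (+ 2) :* w
             :+ ((a :+ con (+ 2)) :* (et :- a :* (con (+ 1) :+ et :* l)) :+ con (+ 2) :* (e :* t :* v))
             :+ (con (+ 2) :* con (+ 2) :* t :* (v₁ :- v₀) :* m :* con (+ 0)
               :+ (:- (et₂ :* (u :+ con (+ 2)))) :* con (+ 1)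
               :+ (et₂ :* (u :+ con (+ 1)) :* con (+ 1) :+ et :* (con (+ 2) :* v₁)))) :=
           a :* (et :- a' :* (con (+ 1) :+ et :* l'))
             :+ (a :* s' :+ ((a :+ con (+ 2)) :* s :+ con (+ 2) :* w)
             :+ (con (+ 2) :* con (+ 2) :* t :* (v₁ :- v₀) :* m :* (e :* e)
               :+ (:- (et₂ :* (u :+ con (+ 2)))) :* (u :* v₀)
               :+ (et₂ :* (u :+ con (+ 1)) :* ((u :+ con (+ 1)) :* v₁) :+ et :* v)))) refl
         ε t (ι r) (ν r) v₀ v₁ (L (r ℕ.+ r)) (S (1# + x) n) (S x n) (w x n))

    -- Small and large residues.

    small-residue : ∀ {a t r} → r ℕ.≤ n → a ≈ ι r + ε * t →
      S a n ≈ 2# * ε * t - A a * T (2# * a)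
    small-residue {a} {t} {r} r≤n a≈r+εt = trans (S-cong n a≈r+εt) (trans (S-expansion t r r≤n)
      (+-congˡ (-‿cong (*-cong (+-congʳ (*-congˡ (sym a≈r+εt))) (sym T-2a)))))
      where
      T-2a : T (2# * a) ≈ 1# + 2# * ε * t * L (r ℕ.+ r)
      T-2a = trans
        (T-cong (trans (*-congˡ a≈r+εt) (trans
          (solve 3 (λ r e t → con (+ 2) :* (r :+ e :* t) := r :+ r :+ e :* (con (+ 2) :* t)) refl (ι r) ε t)
          (+-congʳ (sym (ι-double r))))))
        (trans (T-expansion (2# * t) (r ℕ.+ r) (ℕₚ.+-mono-≤ r≤n r≤n))
          (+-cong (alt-even r) (*-congʳ (solve 2 (λ e t → e :* (con (+ 2) :* t) := con (+ 2) :* e :* t) refl ε t))))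

    -- The residue of a is N - r′, so that of -1 - a is r′, and n - 1 = r′ + d says r′ < n.
    module LargeResidue {a t : Carrier} {r r′ d : ℕ}
      (r+r′≡N : r ℕ.+ r′ ≡ N) (n-1≡r′+d : n-1 ≡ r′ ℕ.+ d) (a≈r+εt : a ≈ ι r + ε * t) where

      g : Carrier
      g = L (r′ ℕ.+ r′)

      ι-r : ι r ≈ ε - 1# - ι r′
      ι-r = by-difference (sym (ι-+ r r′)) (trans
        (solve 3 (λ r r' N → r :+ N := (con (+ 1) :+ N) :- con (+ 1) :- r' :+ (r :+ r')) refl (ι r) (ι r′) (ι (r ℕ.+ r′)))
        (+-congʳ (+-congʳ (+-congʳ (+-congˡ (reflexive (≡.cong ι r+r′≡N)))))))

      r′<n : r′ ℕ.< n
      r′<n = s≤s (≡.subst (r′ ℕ.≤_) (≡.sym n-1≡r′+d) (ℕₚ.m≤m+n r′ d))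

      -- The reflected argument -1 - a has residue r′ and quotient -1 - t, and A(-1 - a) = -A(a).
      S-large : S a n ≈ A a * (1# - 2# * ε * (t + 1#) * g) - 2# * ε * (t + 1#)
      S-large = trans (S-reflection a n) (trans (S-cong n -1-a) (trans
        (S-expansion (- 1# - t) r′ (ℕₚ.<⇒≤ r′<n))
        (trans (+-congˡ (-‿cong (*-congʳ (+-congʳ (*-congˡ (sym -1-a))))))
        (solve 4 (λ e t a g →
           con (+ 2) :* e :* (:- con (+ 1) :- t)
             :- (con (+ 2) :* (:- con (+ 1) :- a) :+ con (+ 1))
                :* (con (+ 1) :+ con (+ 2) :* e :* (:- con (+ 1) :- t) :* g) :=
           (con (+ 2) :* a :+ con (+ 1)) :* (con (+ 1) :- con (+ 2) :* e :* (t :+ con (+ 1)) :* g)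
             :- con (+ 2) :* e :* (t :+ con (+ 1))) refl ε t a g))))
        where
        -1-a : - 1# - a ≈ ι r′ + ε * (- 1# - t)
        -1-a = trans (+-congˡ (-‿cong (trans a≈r+εt (+-congʳ ι-r))))
          (solve 3 (λ e t r' → :- con (+ 1) :- (e :- con (+ 1) :- r' :+ e :* t) :=
             r' :+ e :* (:- con (+ 1) :- t)) refl ε t (ι r′))

      -- The residue of 2a: here 2r = p + s, so 2a = s + ε(2t + 1). This is the origin of 2t + 1,
      -- and since s is odd the leading term of T(2a) is -1.
      s : ℕ
      s = suc (d ℕ.+ d)

      s+1+2r′≡N : suc s ℕ.+ (r′ ℕ.+ r′) ≡ N
      s+1+2r′≡N = ≡.trans
        (ℕ-Solver.solve 2 (λ d r → ℕ-Solver.con 2 ℕ-Solver.:+ (d ℕ-Solver.:+ d) ℕ-Solver.:+ (r ℕ-Solver.:+ r) ℕ-Solver.:=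
          ℕ-Solver.con 1 ℕ-Solver.:+ (r ℕ-Solver.:+ d) ℕ-Solver.:+ (ℕ-Solver.con 1 ℕ-Solver.:+ (r ℕ-Solver.:+ d))) ≡.refl d r′)
        (≡.cong (λ k → suc k ℕ.+ suc k) (≡.sym n-1≡r′+d))

      s<N : s ℕ.< N
      s<N = ≡.subst (suc s ℕ.≤_) s+1+2r′≡N (ℕₚ.m≤m+n (suc s) (r′ ℕ.+ r′))

      ι-s : ι s ≈ ε - 2# - (ι r′ + ι r′)
      ι-s = by-difference (trans (+-congˡ (sym (ι-double r′))) (sym (ι-+ (suc s) (r′ ℕ.+ r′)))) (trans
        (solve 3 (λ s r' N → s :+ N :=
           (con (+ 1) :+ N) :- con (+ 2) :- (r' :+ r') :+ ((con (+ 1) :+ s) :+ (r' :+ r'))) refl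
         (ι s) (ι r′) (ι (suc s ℕ.+ (r′ ℕ.+ r′))))
        (+-congʳ (+-congʳ (+-congʳ (+-congˡ (reflexive (≡.cong ι s+1+2r′≡N)))))))

      -- L(s) is rewritten as 2/(s + 1) - L(s + 1), and L(s + 1) reflects to -L(2r′) because s + 1 +
      -- 2r′ = p - 1. Thus T(2a) and S(a) are expressed by the same value `g`.
      T-2a : T (2# * a) ≈ ε * (2# * t + 1#) * (2# * ν s + g) - 1#
      T-2a = trans
        (T-cong (trans (*-congˡ (trans a≈r+εt (+-congʳ ι-r))) (trans
          (solve 3 (λ e r' t → con (+ 2) :* (e :- con (+ 1) :- r' :+ e :* t) :=
             e :- con (+ 2) :- (r' :+ r') :+ e :* (con (+ 2) :* t :+ con (+ 1))) refl ε (ι r′) t)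
          (+-congʳ (sym ι-s)))))
        (trans (T-expansion (2# * t + 1#) s (ℕₚ.<⇒≤ s<N)) (by-difference
          (+-cong (*-congˡ { - 1#} (alt-even d))
                  (*-congˡ { - (2# * t + 1#)} (L-antisymmetric (r′ ℕ.+ r′) (suc s)
                     (≡.trans (ℕₚ.+-comm (r′ ℕ.+ r′) (suc s)) s+1+2r′≡N))))
          (solve 6 (λ e b l v g a →
             a :* (:- con (+ 1)) :+ e :* b :* l
               :+ ((:- con (+ 1)) :* con (+ 1) :+ (:- b) :* (:- (e :* g))) :=
             e :* b :* (con (+ 2) :* v :+ g) :- con (+ 1)
               :+ ((:- con (+ 1)) :* a :+ (:- b) :* (e :* (con (+ 2) :* v :- l)))) refl
           ε (2# * t + 1#) (L s) (ν s) g (alt (d ℕ.+ d)))))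

      -- Since (2t + 1)(1 + i) = 2(t + 1), the factor 1 + i turns the ε-coefficient of T(2a) into
      -- the one needed for S(a). The surplus 2/(s + 1) contributes -4ε(t + 1), because A(a) ≡ s + 1
      -- modulo p.
      large-residue : ∀ {i} → (2# * t + 1#) * i ≈ 1# →
        S a n ≈ 2# * ε * (t + 1#) - A a * i - A a * (1# + i) * T (2# * a)
      large-residue {i} i-inverse = trans S-large (sym (by-difference
        (+-cong (+-cong (*-congˡ { - (A a * (1# + i))} T-2a)
                        (*-congˡ { - (A a * ε * (2# * ν s + g))} i-inverse))
          (+-cong (*-congˡ { - (2# * 2# * (t + 1#) * ν s * ε)} A-a)
            (+-cong (*-congˡ { - (2# * 2# * (t + 1#) * ε)} (ν-inverse s<N))
                    (*-congˡ { - (2# * 2# * (t + 1#) * ν s * (2# * t + 1#))} ε²≈0))))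
        (solve 8 (λ e t a i T' v g s →
           let b = con (+ 2) :* t :+ con (+ 1)
               t' = t :+ con (+ 1)
               c = :- (con (+ 2) :* con (+ 2) :* t' :* v :* e)
           in
           con (+ 2) :* e :* t' :- a :* i :- a :* (con (+ 1) :+ i) :* T'
             :+ ((:- (a :* (con (+ 1) :+ i))) :* (e :* b :* (con (+ 2) :* v :+ g) :- con (+ 1))
               :+ (:- (a :* e :* (con (+ 2) :* v :+ g))) :* con (+ 1)
               :+ (c :* (con (+ 1) :+ s :+ e :* b)
                 :+ ((:- (con (+ 2) :* con (+ 2) :* t' :* e)) :* con (+ 1)
                 :+ (:- (con (+ 2) :* con (+ 2) :* t' :* v :* b)) :* con (+ 0)))) :=
           a :* (con (+ 1) :- con (+ 2) :* e :* t' :* g) :- con (+ 2) :* e :* t'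
             :+ ((:- (a :* (con (+ 1) :+ i))) :* T'
               :+ (:- (a :* e :* (con (+ 2) :* v :+ g))) :* (b :* i)
               :+ (c :* a
                 :+ ((:- (con (+ 2) :* con (+ 2) :* t' :* e)) :* ((con (+ 1) :+ s) :* v)
                 :+ (:- (con (+ 2) :* con (+ 2) :* t' :* v :* b)) :* (e :* e))))) refl
         ε t (A a) i (T (2# * a)) (ν s) g (ι s))))
        where
        A-a : A a ≈ 1# + ι s + ε * (2# * t + 1#)
        A-a = trans (+-congʳ (*-congˡ (trans a≈r+εt (+-congʳ ι-r)))) (trans
          (solve 3 (λ e r' t → con (+ 2) :* (e :- con (+ 1) :- r' :+ e :* t) :+ con (+ 1) :=
             con (+ 1) :+ (e :- con (+ 2) :- (r' :+ r')) :+ e :* (con (+ 2) :* t :+ con (+ 1))) refl ε (ι r′) t)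
          (+-congʳ (+-congˡ (sym ι-s))))

    -- Comparison with an Euler polynomial in the exceptional case.

    -- `e` stands for the Euler polynomial of degree `n-1 ℕ.+ n`, that is p - 2; the comparison with
    -- L rests on these three properties.
    module EulerPolynomial (e : Carrier → Carrier)
      (e-congruence : ∀ {x y} → ε * x ≈ ε * y → ε * e x ≈ ε * e y)
      (e-reflection : ∀ x → e (1# - x) ≈ - e x)
      (e-step : ∀ x → e (1# + x) + e x ≈ 2# * pow x (n-1 ℕ.+ n)) where

      -- The sequences s ↦ ε e (s + 1) and s ↦ ε L s satisfy the same recurrence, so their
      -- difference alternates; both being antisymmetric, it vanishes.
      defect : ℕ → Carrier
      defect s = ε * e (ι (suc s)) - ε * L s

      defect-alternates : ∀ s → s ℕ.≤ N → defect s ≈ alt s * defect 0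
      defect-alternates zero _ = sym (*-identityˡ _)
      defect-alternates (suc s) s<N = by-difference
        (+-cong (*-congˡ { - 1#} (defect-alternates s (ℕₚ.<⇒≤ s<N)))
          (+-cong (*-congˡ {ε} (e-step (ι (suc s)))) (*-congˡ {2#} (fermat-inverse s<N))))
        (solve 8 (λ e v l e₀ e₁ w a d →
           e :* e₁ :- e :* (con (+ 2) :* v :- l)
             :+ ((:- con (+ 1)) :* (a :* d) :+ (e :* (con (+ 2) :* w) :+ con (+ 2) :* (e :* v))) :=
           a :* (:- con (+ 1)) :* d
             :+ ((:- con (+ 1)) :* (e :* e₀ :- e :* l) :+ (e :* (e₁ :+ e₀) :+ con (+ 2) :* (e :* w)))) refl
         ε (ν s) (L s) (e (ι (suc s))) (e (ι (suc (suc s)))) (pow (ι (suc s)) (n-1 ℕ.+ n)) (alt s) (defect 0))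

      -- As N is even, defect N = defect 0. On the other hand e(p) ≡ e(0) = -e(1) modulo p and εL(N)
      -- = -εL(0) give defect N = -defect 0. Hence twice the defect vanishes, and 2 is a unit.
      defect-0 : defect 0 ≈ 0#
      defect-0 = cancel-ι {1} 1<N (by-difference
        (+-cong (+-cong (sym (trans (defect-alternates N ℕₚ.≤-refl) (trans (*-congʳ alt-N) (*-identityˡ _)))) (-‿cong L-N))
          (+-cong (e-congruence {ε} {0#} (trans ε²≈0 (sym (zeroʳ ε)))) ε-e-1))
        (solve 6 (λ e e₁ eₚ e₀ l₀ l →
           let two = con (+ 1) :+ (con (+ 1) :+ con (+ 0)) in
           two :* (e :* e₁ :- e :* l₀)
             :+ (e :* eₚ :- e :* l :+ (:- (:- (e :* l₀))) :+ (e :* e₀ :+ (:- (e :* e₀)))) :=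
           two :* con (+ 0)
             :+ (e :* e₁ :- e :* l₀ :+ (:- (e :* l)) :+ (e :* eₚ :+ e :* e₁))) refl
         ε (e (ι 1)) (e ε) (e 0#) (L 0) (L N)))
        where
        1<N : 1 ℕ.< N
        1<N = s≤s (ℕₚ.≤-trans (s≤s z≤n) (ℕₚ.m≤n+m n n-1))
        ε-e-1 : ε * e (ι 1) ≈ - (ε * e 0#)
        ε-e-1 = trans (e-congruence (*-congˡ (+-congˡ (sym -0#≈0#))))
          (trans (*-congˡ (e-reflection 0#)) (sym (-‿distribʳ-* ε (e 0#))))

      ε-e : ∀ s → s ℕ.≤ N → ε * e (ι (suc s)) ≈ ε * L s
      ε-e s s≤N = by-difference (trans (defect-alternates s s≤N) (*-congˡ defect-0))
        (solve 3 (λ x y a → x :+ a :* con (+ 0) := y :+ (x :- y)) refl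
         (ε * e (ι (suc s))) (ε * L s) (alt s))

      -- The hypothesis turns 2ε(t + 1) into ε, so S(a) = A - εAg - ε with A = A(a). Modulo p, -2a ≡
      -- 2r′ + 2, hence e(-2a) ≡ L(2r′ + 1) = 2v - g; and A ≡ -(2r′ + 1) makes the contribution of
      -- 2v equal to -2ε.
      half-residue : ∀ {a t r r′ d} → r ℕ.+ r′ ≡ N → n-1 ≡ r′ ℕ.+ d → a ≈ ι r + ε * t →
        ε * (2# * t + 1#) ≈ 0# → S a n ≈ A a + ε * (1# + A a * e (- (2# * a)))
      half-residue {a} {t} {r} {r′} {d} r+r′≡N n-1≡r′+d a≈r+εt half = trans S-large (by-difference
        (+-cong (+-cong (*-congˡ { - (A a * g + 1#)} half) (*-congˡ { - A a} e-at-−2a))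
          (+-cong (*-congˡ { - (2# * ε * v)} A-a)
            (+-cong (*-congˡ {2# * ε} (ν-inverse 2r′<N)) (*-congˡ { - (2# * v * (2# + 2# * t))} ε²≈0))))
        (solve 7 (λ e t a g E v d →
           let c₀ = :- (a :* g :+ con (+ 1))
               c₁ = :- (con (+ 2) :* e :* v)
               c₂ = con (+ 2) :* e
               c₃ = :- (con (+ 2) :* v :* (con (+ 2) :+ con (+ 2) :* t)) in
           a :* (con (+ 1) :- con (+ 2) :* e :* (t :+ con (+ 1)) :* g) :- con (+ 2) :* e :* (t :+ con (+ 1))
             :+ (c₀ :* con (+ 0) :+ (:- a) :* (e :* (con (+ 2) :* v :- g))
               :+ (c₁ :* (e :* (con (+ 2) :+ con (+ 2) :* t) :- (con (+ 1) :+ d))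
                 :+ (c₂ :* con (+ 1) :+ c₃ :* con (+ 0)))) :=
           a :+ e :* (con (+ 1) :+ a :* E)
             :+ (c₀ :* (e :* (con (+ 2) :* t :+ con (+ 1))) :+ (:- a) :* (e :* E)
               :+ (c₁ :* a :+ (c₂ :* ((con (+ 1) :+ d) :* v) :+ c₃ :* (e :* e))))) refl
         ε t (A a) g (e (- (2# * a))) v (ι (r′ ℕ.+ r′))))
        where
        open LargeResidue {r = r} {r′} {d} r+r′≡N n-1≡r′+d a≈r+εt
        v : Carrier
        v = ν (r′ ℕ.+ r′)
        2r′<N : r′ ℕ.+ r′ ℕ.< N
        2r′<N = ℕₚ.+-mono-< r′<n r′<n
        A-a : A a ≈ ε * (2# + 2# * t) - (1# + ι (r′ ℕ.+ r′))
        A-a = trans (+-congʳ (*-congˡ (trans a≈r+εt (+-congʳ ι-r)))) (trans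
          (solve 3 (λ e r' t → con (+ 2) :* (e :- con (+ 1) :- r' :+ e :* t) :+ con (+ 1) :=
             e :* (con (+ 2) :+ con (+ 2) :* t) :- (con (+ 1) :+ (r' :+ r'))) refl ε (ι r′) t)
          (+-congˡ (-‿cong (+-congˡ (sym (ι-double r′))))))
        ε-−2a : ε * - (2# * a) ≈ ε * ι (suc (suc (r′ ℕ.+ r′)))
        ε-−2a = trans (*-congˡ (trans
          (solve 1 (λ a → :- (con (+ 2) :* a) := con (+ 1) :- (con (+ 2) :* a :+ con (+ 1))) refl a)
          (trans (+-congˡ (-‿cong A-a))
            (solve 3 (λ e t d →
               con (+ 1) :- (e :* (con (+ 2) :+ con (+ 2) :* t) :- (con (+ 1) :+ d)) :=
               con (+ 1) :+ (con (+ 1) :+ d) :+ e :* (:- (con (+ 2) :+ con (+ 2) :* t))) refl ε t (ι (r′ ℕ.+ r′))))))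
          (ε-absorbs-ε (ι (suc (suc (r′ ℕ.+ r′)))) (- (2# + 2# * t)))
        e-at-−2a : ε * e (- (2# * a)) ≈ ε * (2# * v - g)
        e-at-−2a = trans (e-congruence ε-−2a) (ε-e (suc (r′ ℕ.+ r′)) 2r′<N)

nC0≡1 : ∀ n → n C 0 ≡ 1
nC0≡1 n = ≡.trans (nCk≡nC[n∸k] {0} {n} z≤n) (nCn≡1 n)

-- Exponential generating functions and Euler numbers.

-- Sequences stand for exponential generating functions: ⋆ is the product, the shift is d/dt, `δ` is
-- 1, `pow x` is exp(xt), `evens` is cosh t, and `alternate` substitutes -t for t. Defining ⋆ by the
-- Leibniz rule keeps binomial coefficients out until `⋆-as-sum`.
module BinomialConvolution {c ℓ : Level} (R : CommutativeRing c ℓ) where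
  open CommutativeRing R
  open SequencesIn R
  open IntegerSolver R
  open import Relation.Binary.Reasoning.Setoid setoid

  Sequence : Set c
  Sequence = ℕ → Carrier

  infix 4 _≗_
  _≗_ : Sequence → Sequence → Set ℓ
  f ≗ g = ∀ k → f k ≈ g k

  -- (f ⋆ g) n = Σₖ (n C k) f (n - k) g k; the shift is a derivation for ⋆.
  infixl 7 _⋆_
  _⋆_ : Sequence → Sequence → Sequence
  (f ⋆ g) zero = f 0 * g 0
  (f ⋆ g) (suc n) = ((λ k → f (suc k)) ⋆ g) n + (f ⋆ (λ k → g (suc k))) n

  ⋆-cong : ∀ {f f′ g g′} → f ≗ f′ → g ≗ g′ → f ⋆ g ≗ f′ ⋆ g′
  ⋆-cong f≗ g≗ zero = *-cong (f≗ 0) (g≗ 0)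
  ⋆-cong f≗ g≗ (suc n) = +-cong (⋆-cong (λ k → f≗ (suc k)) g≗ n) (⋆-cong f≗ (λ k → g≗ (suc k)) n)

  ⋆-distribʳ-+ : ∀ f f′ g → (λ k → f k + f′ k) ⋆ g ≗ λ n → (f ⋆ g) n + (f′ ⋆ g) n
  ⋆-distribʳ-+ f f′ g zero = distribʳ (g 0) (f 0) (f′ 0)
  ⋆-distribʳ-+ f f′ g (suc n) = trans
    (+-cong (⋆-distribʳ-+ (λ k → f (suc k)) (λ k → f′ (suc k)) g n) (⋆-distribʳ-+ f f′ (λ k → g (suc k)) n))
    (solve 4 (λ a b c d → a :+ b :+ (c :+ d) := a :+ c :+ (b :+ d)) refl _ _ _ _)

  ⋆-distribˡ-+ : ∀ f g g′ → f ⋆ (λ k → g k + g′ k) ≗ λ n → (f ⋆ g) n + (f ⋆ g′) n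
  ⋆-distribˡ-+ f g g′ zero = distribˡ (f 0) (g 0) (g′ 0)
  ⋆-distribˡ-+ f g g′ (suc n) = trans
    (+-cong (⋆-distribˡ-+ (λ k → f (suc k)) g g′ n) (⋆-distribˡ-+ f (λ k → g (suc k)) (λ k → g′ (suc k)) n))
    (solve 4 (λ a b c d → a :+ b :+ (c :+ d) := a :+ c :+ (b :+ d)) refl _ _ _ _)

  ⋆-scaleˡ : ∀ x f g → (λ k → f k * x) ⋆ g ≗ λ n → (f ⋆ g) n * x
  ⋆-scaleˡ x f g zero = solve 3 (λ x a b → a :* x :* b := a :* b :* x) refl x (f 0) (g 0)
  ⋆-scaleˡ x f g (suc n) = trans
    (+-cong (⋆-scaleˡ x (λ k → f (suc k)) g n) (⋆-scaleˡ x f (λ k → g (suc k)) n))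
    (sym (distribʳ x _ _))

  ⋆-scaleʳ : ∀ x f g → f ⋆ (λ k → g k * x) ≗ λ n → (f ⋆ g) n * x
  ⋆-scaleʳ x f g zero = sym (*-assoc (f 0) (g 0) x)
  ⋆-scaleʳ x f g (suc n) = trans
    (+-cong (⋆-scaleʳ x (λ k → f (suc k)) g n) (⋆-scaleʳ x f (λ k → g (suc k)) n))
    (sym (distribʳ x _ _))

  ⋆-assoc : ∀ f g h → (f ⋆ g) ⋆ h ≗ f ⋆ (g ⋆ h)
  ⋆-assoc f g h zero = *-assoc (f 0) (g 0) (h 0)
  ⋆-assoc f g h (suc n) = begin
    ((λ k → (f′ ⋆ g) k + (f ⋆ g′) k) ⋆ h) n + ((f ⋆ g) ⋆ h′) n
      ≈⟨ +-congʳ (⋆-distribʳ-+ (f′ ⋆ g) (f ⋆ g′) h n) ⟩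
    (((f′ ⋆ g) ⋆ h) n + ((f ⋆ g′) ⋆ h) n) + ((f ⋆ g) ⋆ h′) n
      ≈⟨ +-cong (+-cong (⋆-assoc f′ g h n) (⋆-assoc f g′ h n)) (⋆-assoc f g h′ n) ⟩
    ((f′ ⋆ (g ⋆ h)) n + (f ⋆ (g′ ⋆ h)) n) + (f ⋆ (g ⋆ h′)) n
      ≈⟨ +-assoc _ _ _ ⟩
    (f′ ⋆ (g ⋆ h)) n + ((f ⋆ (g′ ⋆ h)) n + (f ⋆ (g ⋆ h′)) n)
      ≈⟨ +-congˡ (⋆-distribˡ-+ f (g′ ⋆ h) (g ⋆ h′) n) ⟨
    (f′ ⋆ (g ⋆ h)) n + (f ⋆ (λ k → (g′ ⋆ h) k + (g ⋆ h′) k)) n ∎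
    where
    f′ g′ h′ : Sequence
    f′ k = f (suc k)
    g′ k = g (suc k)
    h′ k = h (suc k)

  ⋆-comm : ∀ f g → f ⋆ g ≗ g ⋆ f
  ⋆-comm f g zero = *-comm (f 0) (g 0)
  ⋆-comm f g (suc n) = trans (+-cong (⋆-comm (λ k → f (suc k)) g n) (⋆-comm f (λ k → g (suc k)) n)) (+-comm _ _)

  pow-⋆ : ∀ x y → pow x ⋆ pow y ≗ pow (x + y)
  pow-⋆ x y zero = *-identityˡ 1#
  pow-⋆ x y (suc n) = begin
    ((λ k → pow x k * x) ⋆ pow y) n + (pow x ⋆ (λ k → pow y k * y)) n
      ≈⟨ +-cong (⋆-scaleˡ x (pow x) (pow y) n) (⋆-scaleʳ y (pow x) (pow y) n) ⟩
    (pow x ⋆ pow y) n * x + (pow x ⋆ pow y) n * y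
      ≈⟨ distribˡ _ x y ⟨
    (pow x ⋆ pow y) n * (x + y)
      ≈⟨ *-congʳ (pow-⋆ x y n) ⟩
    pow (x + y) n * (x + y) ∎

  pow-* : ∀ x y n → pow (x * y) n ≈ pow x n * pow y n
  pow-* x y zero = sym (*-identityˡ 1#)
  pow-* x y (suc n) = trans (*-congʳ (pow-* x y n))
    (solve 4 (λ x y a b → a :* b :* (x :* y) := a :* x :* (b :* y)) refl x y (pow x n) (pow y n))

  δ : Sequence
  δ zero = 1#
  δ (suc _) = 0#

  0-⋆ : ∀ g → (λ _ → 0#) ⋆ g ≗ λ _ → 0#
  0-⋆ g zero = zeroˡ (g 0)
  0-⋆ g (suc n) = trans (+-cong (0-⋆ g n) (0-⋆ _ n)) (+-identityˡ 0#)

  δ-⋆ : ∀ g → δ ⋆ g ≗ g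
  δ-⋆ g zero = *-identityˡ (g 0)
  δ-⋆ g (suc n) = trans (+-cong (0-⋆ g n) (δ-⋆ _ n)) (+-identityˡ _)

  sum≤-head : ∀ n f → sum≤ (suc n) f ≈ f 0 + sum≤ n (λ k → f (suc k))
  sum≤-head zero f = refl
  sum≤-head (suc n) f = trans (+-congʳ (sum≤-head n f)) (+-assoc _ _ _)

  sum≤-+ : ∀ n f g → sum≤ n (λ k → f k + g k) ≈ sum≤ n f + sum≤ n g
  sum≤-+ zero f g = refl
  sum≤-+ (suc n) f g = trans (+-congʳ (sum≤-+ n f g))
    (solve 4 (λ a b c d → a :+ b :+ (c :+ d) := a :+ c :+ (b :+ d)) refl _ _ _ _)

  ⋆-as-sum : ∀ n f g → sum≤ n (λ k → ι (n C k) * f (n ∸ k) * g k) ≈ (f ⋆ g) n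
  ⋆-as-sum zero f g = *-congʳ (trans (*-congʳ (+-identityʳ 1#)) (*-identityˡ (f 0)))
  ⋆-as-sum (suc n) f g = begin
    sum≤ (suc n) (λ k → ι (suc n C k) * f (suc n ∸ k) * g k)
      ≈⟨ sum≤-head n _ ⟩
    ι (suc n C 0) * f (suc n) * g 0 + sum≤ n (λ k → ι (suc n C suc k) * f (n ∸ k) * g (suc k))
      ≈⟨ +-cong (*-congʳ (*-congʳ (reflexive (≡.cong ι (≡.trans (nC0≡1 (suc n)) (≡.sym (nC0≡1 n)))))))
           (trans (sum≤-cong n (λ k _ → trans
              (*-congʳ (*-congʳ (trans (reflexive (≡.cong ι (≡.sym (nCk+nC[k+1]≡[n+1]C[k+1] n k)))) (ι-+ (n C k) (n C suc k)))))
              (solve 4 (λ a b f g → (a :+ b) :* f :* g := b :* f :* g :+ a :* f :* g) refl (ι (n C k)) (ι (n C suc k)) (f (n ∸ k)) (g (suc k)))))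
            (sum≤-+ n _ _)) ⟩
    ι (n C 0) * f (suc n) * g 0 + (sum≤ n (λ k → ι (n C suc k) * f (n ∸ k) * g (suc k))
      + sum≤ n (λ k → ι (n C k) * f (n ∸ k) * g (suc k)))
      ≈⟨ +-assoc _ _ _ ⟨
    (ι (n C 0) * f (suc n) * g 0 + sum≤ n (λ k → ι (n C suc k) * f (n ∸ k) * g (suc k)))
      + sum≤ n (λ k → ι (n C k) * f (n ∸ k) * g (suc k))
      -- The sum is completed by a term at k = n + 1, which vanishes because `n C suc n` is 0.
      ≈⟨ +-congʳ (sum≤-head n (λ k → ι (n C k) * f (suc n ∸ k) * g k)) ⟨
    (sum≤ n (λ k → ι (n C k) * f (suc n ∸ k) * g k) + ι (n C suc n) * f (n ∸ n) * g (suc n))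
      + sum≤ n (λ k → ι (n C k) * f (n ∸ k) * g (suc k))
      ≈⟨ +-cong (trans (+-cong
            (sum≤-cong n (λ k k≤n → *-congʳ (*-congˡ (reflexive (≡.cong f (ℕₚ.+-∸-assoc 1 k≤n))))))
            (trans (*-congʳ (trans (*-congʳ (reflexive (≡.cong ι (k>n⇒nCk≡0 (ℕₚ.n<1+n n))))) (zeroˡ _))) (zeroˡ _)))
          (+-identityʳ _)) refl ⟩
    sum≤ n (λ k → ι (n C k) * f (suc (n ∸ k)) * g k) + sum≤ n (λ k → ι (n C k) * f (n ∸ k) * g (suc k))
      ≈⟨ +-cong (⋆-as-sum n (λ k → f (suc k)) g) (⋆-as-sum n f (λ k → g (suc k))) ⟩
    (f ⋆ g) (suc n) ∎

  appellSum : Sequence → ℕ → Carrier → Carrier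
  appellSum g n y = sum≤ n (λ k → ι (n C k) * pow y (n ∸ k) * g k)

  appellSum-cong : ∀ g n {x y} → x ≈ y → appellSum g n x ≈ appellSum g n y
  appellSum-cong g n x≈y = sum≤-cong n (λ k _ → *-congʳ (*-congˡ (pow-cong (n ∸ k) x≈y)))

  evens : Sequence
  evens 0 = 1#
  evens 1 = 0#
  evens (suc (suc k)) = evens k

  alternate : Sequence → Sequence
  alternate f k = pow (- 1#) k * f k

  alternate-⋆ : ∀ f g → alternate f ⋆ alternate g ≗ alternate (f ⋆ g)
  alternate-⋆ f g zero = solve 2 (λ a b → con (+ 1) :* a :* (con (+ 1) :* b) := con (+ 1) :* (a :* b)) refl (f 0) (g 0)
  alternate-⋆ f g (suc n) = trans
    (+-cong
      (trans (⋆-cong (shift f) (λ _ → refl) n)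
        (trans (⋆-scaleˡ (- 1#) _ (alternate g) n) (*-congʳ (alternate-⋆ (λ k → f (suc k)) g n))))
      (trans (⋆-cong (λ _ → refl) (shift g) n)
        (trans (⋆-scaleʳ (- 1#) (alternate f) _ n) (*-congʳ (alternate-⋆ f (λ k → g (suc k)) n)))))
    (solve 3 (λ s x y → s :* x :* (:- con (+ 1)) :+ s :* y :* (:- con (+ 1)) := s :* (:- con (+ 1)) :* (x :+ y)) refl
      (pow (- 1#) n) _ _)
    where
    shift : ∀ h → (λ k → alternate h (suc k)) ≗ (λ k → alternate (λ j → h (suc j)) k * - 1#)
    shift h k = solve 2 (λ s x → s :* (:- con (+ 1)) :* x := s :* x :* (:- con (+ 1))) refl (pow (- 1#) k) (h (suc k))

  alternate-pow : ∀ x → alternate (pow x) ≗ pow (- x)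
  alternate-pow x k = trans (sym (pow-* (- 1#) x k))
    (pow-cong k (solve 1 (λ x → (:- con (+ 1)) :* x := :- x) refl x))

  alternate-evens : alternate evens ≗ evens
  alternate-evens 0 = *-identityˡ 1#
  alternate-evens 1 = zeroʳ _
  alternate-evens (suc (suc k)) = trans
    (solve 2 (λ s x → s :* (:- con (+ 1)) :* (:- con (+ 1)) :* x := s :* x) refl (pow (- 1#) k) (evens k))
    (alternate-evens k)

  alternate-δ : alternate δ ≗ δ
  alternate-δ zero = *-identityˡ 1#
  alternate-δ (suc k) = zeroʳ _

  twice-evens : ∀ k → pow 1# k + pow (- 1#) k ≈ evens k * (1# + 1#)
  twice-evens 0 = sym (*-identityˡ _)
  twice-evens 1 = solve 0 (con (+ 1) :* con (+ 1) :+ con (+ 1) :* (:- con (+ 1)) := con (+ 0) :* con (+ 2)) refl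
  twice-evens (suc (suc k)) = trans
    (solve 2 (λ a b → a :* con (+ 1) :* con (+ 1) :+ b :* (:- con (+ 1)) :* (:- con (+ 1)) := a :+ b) refl
      (pow 1# k) (pow (- 1#) k))
    (twice-evens k)

  module EulerSequence (𝓔 : Sequence) (𝓔⋆evens : 𝓔 ⋆ evens ≗ δ) where

    -- cosh is even, so `alternate 𝓔` is inverse to `evens` as well, and inverses are unique.
    alternate-𝓔 : alternate 𝓔 ≗ 𝓔
    alternate-𝓔 k = begin
      alternate 𝓔 k                                  ≈⟨ δ-⋆ (alternate 𝓔) k ⟨
      (δ ⋆ alternate 𝓔) k                            ≈⟨ ⋆-cong 𝓔⋆evens (λ _ → refl) k ⟨
      ((𝓔 ⋆ evens) ⋆ alternate 𝓔) k                  ≈⟨ ⋆-assoc 𝓔 evens (alternate 𝓔) k ⟩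
      (𝓔 ⋆ (evens ⋆ alternate 𝓔)) k                  ≈⟨ ⋆-cong (λ _ → refl) inverse k ⟩
      (𝓔 ⋆ δ) k                                      ≈⟨ ⋆-comm 𝓔 δ k ⟩
      (δ ⋆ 𝓔) k                                      ≈⟨ δ-⋆ 𝓔 k ⟩
      𝓔 k                                            ∎
      where
      inverse : evens ⋆ alternate 𝓔 ≗ δ
      inverse j = begin
        (evens ⋆ alternate 𝓔) j            ≈⟨ ⋆-comm evens (alternate 𝓔) j ⟩
        (alternate 𝓔 ⋆ evens) j            ≈⟨ ⋆-cong (λ _ → refl) alternate-evens j ⟨
        (alternate 𝓔 ⋆ alternate evens) j  ≈⟨ alternate-⋆ 𝓔 evens j ⟩
        alternate (𝓔 ⋆ evens) j            ≈⟨ *-congˡ (𝓔⋆evens j) ⟩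
        alternate δ j                      ≈⟨ alternate-δ j ⟩
        δ j                                ∎

    appell-reflection : ∀ y → pow (- y) ⋆ 𝓔 ≗ alternate (pow y ⋆ 𝓔)
    appell-reflection y k = trans
      (⋆-cong (λ j → sym (alternate-pow y j)) (λ j → sym (alternate-𝓔 j)) k)
      (alternate-⋆ (pow y) 𝓔 k)

    -- Coefficients of (exp((y + 1)t) + exp((y - 1)t))/cosh t = 2 exp(yt).
    appell-step : ∀ y n → (pow (y + 1#) ⋆ 𝓔) n + (pow (y - 1#) ⋆ 𝓔) n ≈ pow y n * (1# + 1#)
    appell-step y n = begin
      (pow (y + 1#) ⋆ 𝓔) n + (pow (y - 1#) ⋆ 𝓔) n
        ≈⟨ +-cong (⋆-cong (pow-⋆ y 1#) (λ _ → refl) n) (⋆-cong (pow-⋆ y (- 1#)) (λ _ → refl) n) ⟨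
      ((pow y ⋆ pow 1#) ⋆ 𝓔) n + ((pow y ⋆ pow (- 1#)) ⋆ 𝓔) n
        ≈⟨ +-cong (⋆-assoc (pow y) (pow 1#) 𝓔 n) (⋆-assoc (pow y) (pow (- 1#)) 𝓔 n) ⟩
      (pow y ⋆ (pow 1# ⋆ 𝓔)) n + (pow y ⋆ (pow (- 1#) ⋆ 𝓔)) n
        ≈⟨ ⋆-distribˡ-+ (pow y) (pow 1# ⋆ 𝓔) (pow (- 1#) ⋆ 𝓔) n ⟨
      (pow y ⋆ (λ k → (pow 1# ⋆ 𝓔) k + (pow (- 1#) ⋆ 𝓔) k)) n
        ≈⟨ ⋆-cong (λ _ → refl) doubled n ⟩
      (pow y ⋆ (λ k → δ k * (1# + 1#))) n
        ≈⟨ ⋆-scaleʳ (1# + 1#) (pow y) δ n ⟩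
      (pow y ⋆ δ) n * (1# + 1#)
        ≈⟨ *-congʳ (trans (⋆-comm (pow y) δ n) (δ-⋆ (pow y) n)) ⟩
      pow y n * (1# + 1#) ∎
      where
      doubled : ∀ k → (pow 1# ⋆ 𝓔) k + (pow (- 1#) ⋆ 𝓔) k ≈ δ k * (1# + 1#)
      doubled k = begin
        (pow 1# ⋆ 𝓔) k + (pow (- 1#) ⋆ 𝓔) k         ≈⟨ ⋆-distribʳ-+ (pow 1#) (pow (- 1#)) 𝓔 k ⟨
        ((λ j → pow 1# j + pow (- 1#) j) ⋆ 𝓔) k      ≈⟨ ⋆-cong twice-evens (λ _ → refl) k ⟩
        ((λ j → evens j * (1# + 1#)) ⋆ 𝓔) k          ≈⟨ ⋆-scaleˡ (1# + 1#) evens 𝓔 k ⟩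
        (evens ⋆ 𝓔) k * (1# + 1#)                    ≈⟨ *-congʳ (trans (⋆-comm evens 𝓔 k) (𝓔⋆evens k)) ⟩
        δ k * (1# + 1#)                              ∎

-- Rational arithmetic and the Euler polynomials over ℚ.

open import Data.Rational using (_+_; _*_; _-_; -_; 0ℚ; 1ℚ)
open import Data.Product using (_×_)
open import Relation.Binary.PropositionalEquality using (refl)

ℚ-ring : CommutativeRing _ _
ℚ-ring = ℚₚ.+-*-commutativeRing

module ℚ-Solver = IntegerSolver ℚ-ring
module ℚ-Sequences = SequencesIn ℚ-ring
open BinomialConvolution ℚ-ring using (_⋆_; ⋆-as-sum; δ; evens; sum≤-head; pow-*)
  renaming (module EulerSequence to ℚ-EulerSequence)

/1-homo-+ : ∀ i j → (i ℤ.+ j) ℚ./ 1 ≡ i ℚ./ 1 + j ℚ./ 1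
/1-homo-+ i j = ℚₚ.toℚᵘ-injective (ℚᵘₚ.≃-trans (ℚₚ.toℚᵘ-fromℚᵘ (mkℚᵘ (i ℤ.+ j) 0))
  (ℚᵘₚ.≃-trans (ℚᵘ.*≡* (≡.cong (ℤ._* + 1) (≡.cong₂ ℤ._+_ (≡.sym (ℤₚ.*-identityʳ i)) (≡.sym (ℤₚ.*-identityʳ j)))))
  (ℚᵘₚ.≃-trans (ℚᵘₚ.+-cong (ℚᵘₚ.≃-sym (ℚₚ.toℚᵘ-fromℚᵘ (mkℚᵘ i 0))) (ℚᵘₚ.≃-sym (ℚₚ.toℚᵘ-fromℚᵘ (mkℚᵘ j 0))))
  (ℚᵘₚ.≃-sym (ℚₚ.toℚᵘ-homo-+ (i ℚ./ 1) (j ℚ./ 1))))))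

/-factor : ∀ i j d → (i ℤ.* j) ℚ./ suc d ≡ (i ℚ./ 1) * (j ℚ./ suc d)
/-factor i j d = ℚₚ.toℚᵘ-injective (ℚᵘₚ.≃-trans (ℚₚ.toℚᵘ-fromℚᵘ (mkℚᵘ (i ℤ.* j) d))
  (ℚᵘₚ.≃-trans (ℚᵘ.*≡* (≡.cong (λ k → i ℤ.* j ℤ.* + suc k) (ℕₚ.+-identityʳ d)))
  (ℚᵘₚ.≃-trans (ℚᵘₚ.*-cong (ℚᵘₚ.≃-sym (ℚₚ.toℚᵘ-fromℚᵘ (mkℚᵘ i 0))) (ℚᵘₚ.≃-sym (ℚₚ.toℚᵘ-fromℚᵘ (mkℚᵘ j d))))
  (ℚᵘₚ.≃-sym (ℚₚ.toℚᵘ-homo-* (i ℚ./ 1) (j ℚ./ suc d))))))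

ℕ→ℚ-suc : ∀ k → ℕ→ℚ (suc k) ≡ 1ℚ + ℕ→ℚ k
ℕ→ℚ-suc k = /1-homo-+ (+ 1) (+ k)

ℕ→ℚ-* : ∀ j k → ℕ→ℚ (j ℕ.* k) ≡ ℕ→ℚ j * ℕ→ℚ k
ℕ→ℚ-* j k = ≡.trans (≡.cong (ℚ._/ 1) (ℤₚ.pos-* j k)) (/-factor (+ j) (+ k) 0)

ι≡ℕ→ℚ : ∀ k → ℚ-Sequences.ι k ≡ ℕ→ℚ k
ι≡ℕ→ℚ zero = refl
ι≡ℕ→ℚ (suc k) = ≡.trans (≡.cong (λ x → 1ℚ + x) (ι≡ℕ→ℚ k)) (≡.sym (ℕ→ℚ-suc k))

sum≤≡Σ : ∀ n {f g} → (∀ k → k ℕ.≤ n → f k ≡ g k) → ℚ-Sequences.sum≤ n f ≡ Σ[0≤k≤ n ] g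
sum≤≡Σ zero f≡g = f≡g 0 z≤n
sum≤≡Σ (suc n) f≡g =
  ≡.cong₂ _+_ (sum≤≡Σ n (λ k k≤n → f≡g k (ℕₚ.m≤n⇒m≤1+n k≤n))) (f≡g (suc n) ℕₚ.≤-refl)

pow≡^ℚ : ∀ x k → ℚ-Sequences.pow x k ≡ x ^ℚ k
pow≡^ℚ x zero = refl
pow≡^ℚ x (suc k) = ≡.cong (_* x) (pow≡^ℚ x k)

inverse-of-nonzero : ∀ {x} → x ≢ 0ℚ → x * inv x ≡ 1ℚ
inverse-of-nonzero {mkℚ (+ zero) d c} x≢0 = contradiction (ℚₚ.↥p≡0⇒p≡0 (mkℚ (+ zero) d c) refl) x≢0
inverse-of-nonzero {x@(mkℚ +[1+ _ ] _ _)} _ = ℚₚ.*-inverseʳ x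
inverse-of-nonzero {x@(mkℚ -[1+ _ ] _ _)} _ = ℚₚ.*-inverseʳ x

0≢1 : 0ℚ ≢ 1ℚ
0≢1 ()

inv-unique : ∀ {x y} → x * y ≡ 1ℚ → inv x ≡ y
inv-unique {x} {y} xy≡1 = begin
  inv x            ≡⟨ ℚₚ.*-identityʳ (inv x) ⟨
  inv x * 1ℚ       ≡⟨ ≡.cong (inv x *_) xy≡1 ⟨
  inv x * (x * y)  ≡⟨ solve 3 (λ i x y → i :* (x :* y) := x :* i :* y) refl (inv x) x y ⟩
  x * inv x * y    ≡⟨ ≡.cong (_* y) (inverse-of-nonzero x≢0) ⟩
  1ℚ * y           ≡⟨ ℚₚ.*-identityˡ y ⟩
  y                ∎
  where
  open ≡.≡-Reasoning
  open ℚ-Solver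
  x≢0 : x ≢ 0ℚ
  x≢0 x≡0 = 0≢1 (≡.trans (≡.sym (ℚₚ.*-zeroˡ y)) (≡.trans (≡.cong (_* y) (≡.sym x≡0)) xy≡1))

module ℚ-Euler where
  open ℚ-Sequences

  -- The parity test of the Euler recursion becomes the factor `evens (suc i)`, so that the
  -- recursion reads as a convolution.
  weightedSum : ℕ → ℕ → List ℚ → ℚ
  weightedSum m i [] = 0ℚ
  weightedSum m i (e ∷ l) = ℕ→ℚ (m C suc i) * e * evens (suc i) + weightedSum m (suc i) l

  parity : ∀ i → (i ℕ.% 2 ≡ 0 × evens (suc i) ≡ 0ℚ) ⊎ (i ℕ.% 2 ≡ 1 × evens (suc i) ≡ 1ℚ)
  parity 0 = inj₁ (refl , refl)
  parity 1 = inj₂ (refl , refl)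
  parity (suc (suc i)) = parity i

  -- The recursion behind eulerList is private to Defs; the underscore is resolved to it by E-suc.
  mutual
    E-suc : ∀ n → E (suc n) ≡ - weightedSum (suc n) 0 (eulerList n)
    -- The abstraction turns the three arguments into distinct variables, which lets unification
    -- solve the underscore.
    E-suc n with suc n | 0 | eulerList n
    ... | m | i | l = ≡.cong -_ (eulerSum≡weightedSum m i l)

    eulerSum≡weightedSum : ∀ m i l → _ ≡ weightedSum m i l
    eulerSum≡weightedSum m i [] = refl
    eulerSum≡weightedSum m i (e ∷ l) with i ℕ.% 2 | parity i
    ... | _ | inj₁ (refl , even) = ≡.trans (eulerSum≡weightedSum m (suc i) l)
      (≡.sym (≡.trans (≡.cong (λ c → ℕ→ℚ (m C suc i) * e * c + weightedSum m (suc i) l) even)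
        (≡.trans (≡.cong (_+ weightedSum m (suc i) l) (ℚₚ.*-zeroʳ (ℕ→ℚ (m C suc i) * e))) (ℚₚ.+-identityˡ (weightedSum m (suc i) l)))))
    ... | _ | inj₂ (refl , odd) = ≡.cong₂ _+_
      (≡.sym (≡.trans (≡.cong (ℕ→ℚ (m C suc i) * e *_) odd) (ℚₚ.*-identityʳ (ℕ→ℚ (m C suc i) * e))))
      (eulerSum≡weightedSum m (suc i) l)

  weightedSum-as-sum : ∀ m i n → weightedSum m i (eulerList n) ≡
    sum≤ n (λ k → ℕ→ℚ (m C suc (i ℕ.+ k)) * E (n ∸ k) * evens (suc (i ℕ.+ k)))
  weightedSum-as-sum m i zero rewrite ℕₚ.+-identityʳ i = ℚₚ.+-identityʳ (ℕ→ℚ (m C suc i) * 1ℚ * evens (suc i))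
  weightedSum-as-sum m i (suc n) = ≡.trans
    (≡.cong₂ _+_
      (≡.cong (λ j → ℕ→ℚ (m C suc j) * E (suc n) * evens (suc j)) (≡.sym (ℕₚ.+-identityʳ i)))
      (≡.trans (weightedSum-as-sum m (suc i) n)
        (sum≤-cong n (λ k _ → ≡.cong (λ j → ℕ→ℚ (m C suc j) * E (n ∸ k) * evens (suc j)) (≡.sym (ℕₚ.+-suc i k))))))
    (≡.sym (sum≤-head n (λ k → ℕ→ℚ (m C suc (i ℕ.+ k)) * E (suc n ∸ k) * evens (suc (i ℕ.+ k)))))

  E-recurrence : ∀ n → E (suc n) ≡
    - sum≤ n (λ k → ℕ→ℚ (suc n C suc k) * E (n ∸ k) * evens (suc k))
  E-recurrence n = ≡.trans (E-suc n) (≡.cong -_ (weightedSum-as-sum (suc n) 0 n))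

  -- The Euler numbers generate 1/cosh: the term k = 0 of the convolution is `E (suc n)`, and the
  -- recurrence says that the remaining terms sum to its negative.
  E⋆evens : ∀ n → (E ⋆ evens) n ≡ δ n
  E⋆evens zero = refl
  E⋆evens (suc n) = begin
    (E ⋆ evens) (suc n)
      ≡⟨ ⋆-as-sum (suc n) E evens ⟨
    sum≤ (suc n) (λ k → ι (suc n C k) * E (suc n ∸ k) * evens k)
      ≡⟨ sum≤-head n _ ⟩
    ι (suc n C 0) * E (suc n) * 1ℚ + sum≤ n (λ k → ι (suc n C suc k) * E (n ∸ k) * evens (suc k))
      ≡⟨ ≡.cong₂ _+_
           (≡.trans (ℚₚ.*-identityʳ (ι (suc n C 0) * E (suc n))) (≡.trans (≡.cong (λ j → ι j * E (suc n)) (nC0≡1 (suc n))) (ℚₚ.*-identityˡ (E (suc n)))))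
           (sum≤-cong n (λ k _ → ≡.cong (λ c → c * E (n ∸ k) * evens (suc k)) (ι≡ℕ→ℚ (suc n C suc k)))) ⟩
    E (suc n) + sum≤ n tail
      ≡⟨ ≡.cong (_+ sum≤ n tail) (E-recurrence n) ⟩
    - sum≤ n tail + sum≤ n tail
      ≡⟨ ℚₚ.+-inverseˡ (sum≤ n tail) ⟩
    0ℚ ∎
    where
    open ≡.≡-Reasoning
    tail : ℕ → ℚ
    tail k = ℕ→ℚ (suc n C suc k) * E (n ∸ k) * evens (suc k)

  open ℚ-EulerSequence E E⋆evens public
  open ℚ-Solver

  half : ℚ
  half = inv (ℕ→ℚ 2)

  pow-half-inverse : ∀ n → (ℕ→ℚ 2 ^ℚ n) * pow half n ≡ 1ℚ
  pow-half-inverse zero = refl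
  pow-half-inverse (suc n) = ≡.trans
    (solve 4 (λ a b c d → a :* b :* (c :* d) := a :* c :* (b :* d)) refl (ℕ→ℚ 2 ^ℚ n) (ℕ→ℚ 2) (pow half n) half)
    (≡.cong (_* (ℕ→ℚ 2 * half)) (pow-half-inverse n))

  Epoly-as-⋆ : ∀ n x → Epoly n x ≡ pow half n * (pow (ℕ→ℚ 2 * x - 1ℚ) ⋆ E) n
  Epoly-as-⋆ n x = ≡.cong₂ _*_ (inv-unique {ℕ→ℚ 2 ^ℚ n} (pow-half-inverse n))
    (≡.trans
      (≡.sym (sum≤≡Σ n (λ k _ → ≡.cong (_* E k) (≡.cong₂ _*_ (ι≡ℕ→ℚ (n C k)) (pow≡^ℚ (ℕ→ℚ 2 * x - 1ℚ) (n ∸ k))))))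
      (⋆-as-sum n (pow (ℕ→ℚ 2 * x - 1ℚ)) E))

  Epoly-reflection : ∀ n x → pow (- 1ℚ) n ≡ - 1ℚ → Epoly n (1ℚ - x) ≡ - Epoly n x
  Epoly-reflection n x odd = begin
    Epoly n (1ℚ - x)                                  ≡⟨ Epoly-as-⋆ n (1ℚ - x) ⟩
    pow half n * (pow (ℕ→ℚ 2 * (1ℚ - x) - 1ℚ) ⋆ E) n  ≡⟨ ≡.cong (λ y → pow half n * (pow y ⋆ E) n) flip ⟩
    pow half n * (pow (- (ℕ→ℚ 2 * x - 1ℚ)) ⋆ E) n     ≡⟨ ≡.cong (pow half n *_) (appell-reflection (ℕ→ℚ 2 * x - 1ℚ) n) ⟩
    pow half n * (pow (- 1ℚ) n * F)                   ≡⟨ ≡.cong (λ s → pow half n * (s * F)) odd ⟩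
    pow half n * (- 1ℚ * F)                           ≡⟨ solve 2 (λ h f → h :* ((:- con (+ 1)) :* f) := :- (h :* f)) refl (pow half n) F ⟩
    - (pow half n * F)                                ≡⟨ ≡.cong -_ (Epoly-as-⋆ n x) ⟨
    - Epoly n x                                       ∎
    where
    open ≡.≡-Reasoning
    F : ℚ
    F = (pow (ℕ→ℚ 2 * x - 1ℚ) ⋆ E) n
    flip : ℕ→ℚ 2 * (1ℚ - x) - 1ℚ ≡ - (ℕ→ℚ 2 * x - 1ℚ)
    flip = solve 1 (λ x → con (+ 2) :* (con (+ 1) :- x) :- con (+ 1) := :- (con (+ 2) :* x :- con (+ 1))) refl x

  -- With y = 2x the two Appell arguments are y + 1 and y - 1, and 2^(-n) y^n = x^n.
  Epoly-step : ∀ n x → Epoly n (1ℚ + x) + Epoly n x ≡ ℕ→ℚ 2 * pow x n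
  Epoly-step n x = begin
    Epoly n (1ℚ + x) + Epoly n x
      ≡⟨ ≡.cong₂ _+_ (Epoly-as-⋆ n (1ℚ + x)) (Epoly-as-⋆ n x) ⟩
    pow half n * (pow (ℕ→ℚ 2 * (1ℚ + x) - 1ℚ) ⋆ E) n + pow half n * (pow (ℕ→ℚ 2 * x - 1ℚ) ⋆ E) n
      ≡⟨ ℚₚ.*-distribˡ-+ (pow half n) _ _ ⟨
    pow half n * ((pow (ℕ→ℚ 2 * (1ℚ + x) - 1ℚ) ⋆ E) n + (pow (ℕ→ℚ 2 * x - 1ℚ) ⋆ E) n)
      ≡⟨ ≡.cong (λ y → pow half n * ((pow y ⋆ E) n + (pow (ℕ→ℚ 2 * x - 1ℚ) ⋆ E) n))
           (solve 1 (λ x → con (+ 2) :* (con (+ 1) :+ x) :- con (+ 1) := con (+ 2) :* x :+ con (+ 1)) refl x) ⟩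
    pow half n * ((pow (ℕ→ℚ 2 * x + 1ℚ) ⋆ E) n + (pow (ℕ→ℚ 2 * x - 1ℚ) ⋆ E) n)
      ≡⟨ ≡.cong (pow half n *_) (appell-step (ℕ→ℚ 2 * x) n) ⟩
    pow half n * (pow (ℕ→ℚ 2 * x) n * ℕ→ℚ 2)
      ≡⟨ ≡.cong (λ y → pow half n * (y * ℕ→ℚ 2)) (pow-* (ℕ→ℚ 2) x n) ⟩
    pow half n * (pow (ℕ→ℚ 2) n * pow x n * ℕ→ℚ 2)
      ≡⟨ solve 4 (λ h t x c → h :* (t :* x :* c) := t :* h :* (c :* x)) refl (pow half n) (pow (ℕ→ℚ 2) n) (pow x n) (ℕ→ℚ 2) ⟩
    pow (ℕ→ℚ 2) n * pow half n * (ℕ→ℚ 2 * pow x n)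
      ≡⟨ ≡.cong (λ y → y * pow half n * (ℕ→ℚ 2 * pow x n)) (pow≡^ℚ (ℕ→ℚ 2) n) ⟩
    (ℕ→ℚ 2 ^ℚ n) * pow half n * (ℕ→ℚ 2 * pow x n)
      ≡⟨ ≡.cong (_* (ℕ→ℚ 2 * pow x n)) (pow-half-inverse n) ⟩
    1ℚ * (ℕ→ℚ 2 * pow x n)
      ≡⟨ ℚₚ.*-identityˡ (ℕ→ℚ 2 * pow x n) ⟩
    ℕ→ℚ 2 * pow x n ∎
    where open ≡.≡-Reasoning

-- The ring of p-integral rationals modulo a power of p.

module Localisation (p : ℕ) (p-prime : Prime p) where
  open ℚ-Solver
  open ≡.≡-Reasoning

  p∤1 : ¬ p ∣ 1
  p∤1 p∣1 = contradiction (≡.subst Prime (∣1⇒≡1 p∣1) p-prime) ¬prime[1]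

  -- The reduced denominator divides the unreduced one `d`, and `g` is the gcd that was cancelled;
  -- so it suffices that p does not divide `d`.
  integral-by-multiple : ∀ x g {d} → ℚ.↧ x ℤ.* g ≡ + d → ¬ p ∣ d → InZp p x
  integral-by-multiple x g ↧x*g≡d p∤d p∣↧x = p∤d
    (≡.subst (p ∣_) (≡.trans (≡.sym (ℤₚ.abs-* (ℚ.↧ x) g)) (≡.cong ℤ.∣_∣ ↧x*g≡d)) (∣m⇒∣m*n ℤ.∣ g ∣ p∣↧x))

  p∤* : ∀ {m n} → ¬ p ∣ m → ¬ p ∣ n → ¬ p ∣ m ℕ.* n
  p∤* {m} {n} p∤m p∤n p∣mn with euclidsLemma m n p-prime p∣mn
  ... | inj₁ p∣m = p∤m p∣m
  ... | inj₂ p∣n = p∤n p∣n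

  integral-/ : ∀ i d → ¬ p ∣ suc d → InZp p (i ℚ./ suc d)
  integral-/ i d = integral-by-multiple (i ℚ./ suc d) (gcd i (+ suc d)) (ℚₚ.↧-/ i (suc d))

  integral-ℕ : ∀ k → InZp p (ℕ→ℚ k)
  integral-ℕ k = integral-/ (+ k) 0 p∤1

  integral-+ : ∀ x y → InZp p x → InZp p y → InZp p (x + y)
  integral-+ x y ix iy = integral-by-multiple (x + y)
    (gcd (ℚ.↥ x ℤ.* ℚ.↧ y ℤ.+ ℚ.↥ y ℤ.* ℚ.↧ x) (ℚ.↧ x ℤ.* ℚ.↧ y))
    (≡.trans (ℚₚ.↧-+ x y) (≡.sym (ℤₚ.pos-* (ℚ.↧ₙ x) (ℚ.↧ₙ y)))) (p∤* ix iy)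

  integral-* : ∀ x y → InZp p x → InZp p y → InZp p (x * y)
  integral-* x y ix iy = integral-by-multiple (x * y)
    (gcd (ℚ.↥ x ℤ.* ℚ.↥ y) (ℚ.↧ x ℤ.* ℚ.↧ y))
    (≡.trans (ℚₚ.↧-* x y) (≡.sym (ℤₚ.pos-* (ℚ.↧ₙ x) (ℚ.↧ₙ y)))) (p∤* ix iy)

  integral-neg : ∀ x → InZp p x → InZp p (- x)
  integral-neg x ix p∣↧ = ix (≡.subst (p ∣_) (≡.cong ℤ.∣_∣ (ℚₚ.↧-neg x)) p∣↧)

  integral-^ : ∀ x k → InZp p x → InZp p (x ^ℚ k)
  integral-^ x zero ix = integral-ℕ 1
  integral-^ x (suc k) ix = integral-* (x ^ℚ k) x (integral-^ x k ix) ix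

  integral-Σ : ∀ f n → (∀ k → k ℕ.≤ n → InZp p (f k)) → InZp p (Σ[0≤k≤ n ] f)
  integral-Σ f zero h = h 0 z≤n
  integral-Σ f (suc n) h =
    integral-+ (Σ[0≤k≤ n ] f) (f (suc n)) (integral-Σ f n (λ k k≤n → h k (ℕₚ.m≤n⇒m≤1+n k≤n))) (h (suc n) ℕₚ.≤-refl)

  integral-inv : ∀ x → ¬ p ∣ ℤ.∣ ℚ.↥ x ∣ → InZp p (inv x)
  integral-inv (mkℚ (+ zero) d c) _ = integral-ℕ 0
  integral-inv (mkℚ +[1+ n ] d c) p∤n = p∤n
  integral-inv (mkℚ -[1+ n ] d c) p∤n = p∤n

  integral-inv-ℕ : ∀ k → ¬ p ∣ k → InZp p (inv (ℕ→ℚ k))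
  integral-inv-ℕ k p∤k = integral-inv (ℕ→ℚ k) λ p∣↥ → p∤k (≡.subst (p ∣_)
    (≡.trans (≡.sym (ℤₚ.abs-* (ℚ.↥ ℕ→ℚ k) (gcd (+ k) (+ 1)))) (≡.cong ℤ.∣_∣ (ℚₚ.↥-/ (+ k) 1))) (∣m⇒∣m*n ℤ.∣ gcd (+ k) (+ 1) ∣ p∣↥))

  p-multiple : ∀ x → InZp p x → p ∣ ℤ.∣ ℚ.↥ x ∣ → Σ ℚ (λ z → InZp p z × x ≡ ℕ→ℚ p * z)
  p-multiple x@(mkℚ i d _) ix p∣↥ =
    quotient ℚ./ suc d , integral-/ quotient d ix , ≡.trans (≡.sym (ℚₚ.↥p/↧p≡p x))
      (≡.trans (ℚₚ./-cong factor refl) (/-factor (+ p) quotient d))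
    where
    open _∣_ p∣↥ renaming (quotient to q; equality to ∣i∣≡q*p)
    quotient : ℤ
    quotient = ℤ.sign i ℤ.◃ q
    factor : i ≡ + p ℤ.* quotient
    factor = begin
      i                                            ≡⟨ ℤₚ.◃-inverse i ⟨
      ℤ.sign i ℤ.◃ ℤ.∣ i ∣                         ≡⟨ ≡.cong (ℤ.sign i ℤ.◃_) (≡.trans ∣i∣≡q*p (ℕₚ.*-comm q p)) ⟩
      ℤ.sign i ℤ.◃ (p ℕ.* q)                       ≡⟨ ℤₚ.◃-distrib-* Sign.+ (ℤ.sign i) p q ⟩
      (Sign.+ ℤ.◃ p) ℤ.* (ℤ.sign i ℤ.◃ q)          ≡⟨ ≡.cong (ℤ._* quotient) (ℤₚ.+◃n≡+n p) ⟩
      + p ℤ.* quotient                             ∎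

  open ℚ-Euler using (E-recurrence)

  integral-evens : ∀ k → InZp p (evens k)
  integral-evens 0 = integral-ℕ 1
  integral-evens 1 = integral-ℕ 0
  integral-evens (suc (suc k)) = integral-evens k

  integral-E : ∀ n → InZp p (E n)
  integral-E n = below n n ℕₚ.≤-refl
    where
    below : ∀ n j → j ℕ.≤ n → InZp p (E j)
    below n zero _ = integral-ℕ 1
    below (suc n) (suc j) (s≤s j≤n) = ≡.subst (InZp p)
      (≡.trans (≡.cong -_ (≡.sym (sum≤≡Σ j (λ _ _ → refl)))) (≡.sym (E-recurrence j)))
      (integral-neg (Σ[0≤k≤ j ] summand) (integral-Σ summand j (λ k _ →
        integral-* (ℕ→ℚ (suc j C suc k) * E (j ∸ k)) (evens (suc k))
          (integral-* (ℕ→ℚ (suc j C suc k)) (E (j ∸ k)) (integral-ℕ (suc j C suc k))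
            (below n (j ∸ k) (ℕₚ.≤-trans (ℕₚ.m∸n≤m j k) j≤n)))
          (integral-evens (suc k)))))
      where
      summand : ℕ → ℚ
      summand k = ℕ→ℚ (suc j C suc k) * E (j ∸ k) * evens (suc k)

  integral-inv-2^ : ∀ n → ¬ p ∣ 2 → InZp p (inv (ℕ→ℚ 2 ^ℚ n))
  integral-inv-2^ n p∤2 = ≡.subst (InZp p)
    (≡.sym (≡.trans (inv-unique {ℕ→ℚ 2 ^ℚ n} (ℚ-Euler.pow-half-inverse n)) (pow≡^ℚ (inv (ℕ→ℚ 2)) n)))
    (integral-^ (inv (ℕ→ℚ 2)) n (integral-inv-ℕ 2 p∤2))

  -- The main argument takes m = 2; m = 1 serves to show that Euler polynomials respect congruence
  -- modulo p.
  module Modulo (m : ℕ) where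

    M : ℚ
    M = ℕ→ℚ (p ℕ.^ m)

    CongMod-reflexive : ∀ x y → x ≡ y → CongMod p m x y
    CongMod-reflexive x y x≡y = 0ℚ , integral-ℕ 0 ,
      ≡.trans (≡.cong (_- y) x≡y) (solve 2 (λ y m → y :- y := m :* con (+ 0)) refl y M)

    CongMod-sym : ∀ x y → CongMod p m x y → CongMod p m y x
    CongMod-sym x y (z , iz , eq) = - z , integral-neg z iz , (begin
      y - x      ≡⟨ solve 2 (λ x y → y :- x := :- (x :- y)) refl x y ⟩
      - (x - y)  ≡⟨ ≡.cong -_ eq ⟩
      - (M * z)  ≡⟨ solve 2 (λ m z → :- (m :* z) := m :* :- z) refl M z ⟩
      M * - z    ∎)

    CongMod-trans : ∀ x y w → CongMod p m x y → CongMod p m y w → CongMod p m x w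
    CongMod-trans x y w (z , iz , eq) (z′ , iz′ , eq′) = z + z′ , integral-+ z z′ iz iz′ , (begin
      x - w              ≡⟨ solve 3 (λ x y w → x :- w := (x :- y) :+ (y :- w)) refl x y w ⟩
      (x - y) + (y - w)  ≡⟨ ≡.cong₂ _+_ eq eq′ ⟩
      M * z + M * z′     ≡⟨ ℚₚ.*-distribˡ-+ M z z′ ⟨
      M * (z + z′)       ∎)

    CongMod-+ : ∀ x x′ y y′ → CongMod p m x x′ → CongMod p m y y′ → CongMod p m (x + y) (x′ + y′)
    CongMod-+ x x′ y y′ (z , iz , eq) (z′ , iz′ , eq′) = z + z′ , integral-+ z z′ iz iz′ , (begin
      (x + y) - (x′ + y′)    ≡⟨ solve 4 (λ x x' y y' → (x :+ y) :- (x' :+ y') := (x :- x') :+ (y :- y')) refl x x′ y y′ ⟩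
      (x - x′) + (y - y′)    ≡⟨ ≡.cong₂ _+_ eq eq′ ⟩
      M * z + M * z′         ≡⟨ ℚₚ.*-distribˡ-+ M z z′ ⟨
      M * (z + z′)           ∎)

    CongMod-* : ∀ x x′ y y′ → InZp p x′ → InZp p y →
      CongMod p m x x′ → CongMod p m y y′ → CongMod p m (x * y) (x′ * y′)
    CongMod-* x x′ y y′ ix′ iy (z , iz , eq) (z′ , iz′ , eq′) =
      z * y + x′ * z′ , integral-+ (z * y) (x′ * z′) (integral-* z y iz iy) (integral-* x′ z′ ix′ iz′) , (begin
      x * y - x′ * y′                ≡⟨ solve 4 (λ x x' y y' → x :* y :- x' :* y' := (x :- x') :* y :+ x' :* (y :- y')) refl x x′ y y′ ⟩
      (x - x′) * y + x′ * (y - y′)   ≡⟨ ≡.cong₂ (λ u v → u * y + x′ * v) eq eq′ ⟩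
      M * z * y + x′ * (M * z′)      ≡⟨ solve 5 (λ m z y x' z' → m :* z :* y :+ x' :* (m :* z') := m :* (z :* y :+ x' :* z')) refl M z y x′ z′ ⟩
      M * (z * y + x′ * z′)          ∎)

    CongMod-neg : ∀ x y → CongMod p m x y → CongMod p m (- x) (- y)
    CongMod-neg x y (z , iz , eq) = - z , integral-neg z iz , (begin
      - x - - y  ≡⟨ solve 2 (λ x y → :- x :- (:- y) := :- (x :- y)) refl x y ⟩
      - (x - y)  ≡⟨ ≡.cong -_ eq ⟩
      - (M * z)  ≡⟨ solve 2 (λ m z → :- (m :* z) := m :* :- z) refl M z ⟩
      M * - z    ∎)

    record Zp : Set where
      constructor _#_
      field
        val : ℚ
        integral : InZp p val
    open Zp public

    infix 4 _≈_
    -- `CongMod` mentions only the values, from which the integrality proofs cannot be recovered;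
    -- the record keeps `x` and `y` inferable.
    record _≈_ (x y : Zp) : Set where
      constructor modulo
      field
        congruent : CongMod p m (val x) (val y)
    open _≈_ public

    from-≡ : ∀ {x y} → val x ≡ val y → x ≈ y
    from-≡ {x} {y} eq = modulo (CongMod-reflexive (val x) (val y) eq)

    Zp-ring : CommutativeRing _ _
    Zp-ring = record
      { Carrier = Zp
      ; _≈_ = _≈_
      ; _+_ = λ x y → (val x + val y) # integral-+ (val x) (val y) (integral x) (integral y)
      ; _*_ = λ x y → (val x * val y) # integral-* (val x) (val y) (integral x) (integral y)
      ; -_ = λ x → (- val x) # integral-neg (val x) (integral x)
      ; 0# = 0ℚ # integral-ℕ 0
      ; 1# = 1ℚ # integral-ℕ 1
      ; isCommutativeRing = record
        { isRing = record
          { +-isAbelianGroup = record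
            { isGroup = record
              { isMonoid = record
                { isSemigroup = record
                  { isMagma = record
                    { isEquivalence = record
                      { refl = from-≡ refl
                      ; sym = λ {x} {y} x≈y → modulo (CongMod-sym (val x) (val y) (congruent x≈y))
                      ; trans = λ {x} {y} {z} x≈y y≈z → modulo (CongMod-trans (val x) (val y) (val z) (congruent x≈y) (congruent y≈z))
                      }
                    ; ∙-cong = λ {x} {y} {u} {v} x≈y u≈v → modulo (CongMod-+ (val x) (val y) (val u) (val v) (congruent x≈y) (congruent u≈v))
                    }
                  ; assoc = λ x y z → from-≡ (ℚₚ.+-assoc (val x) (val y) (val z))
                  }
                ; identity = (λ x → from-≡ (ℚₚ.+-identityˡ (val x))) , (λ x → from-≡ (ℚₚ.+-identityʳ (val x)))
                }
              ; inverse = (λ x → from-≡ (ℚₚ.+-inverseˡ (val x))) , (λ x → from-≡ (ℚₚ.+-inverseʳ (val x)))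
              ; ⁻¹-cong = λ {x} {y} x≈y → modulo (CongMod-neg (val x) (val y) (congruent x≈y))
              }
            ; comm = λ x y → from-≡ (ℚₚ.+-comm (val x) (val y))
            }
          ; *-cong = λ {x} {y} {u} {v} x≈y u≈v →
              modulo (CongMod-* (val x) (val y) (val u) (val v) (integral y) (integral u) (congruent x≈y) (congruent u≈v))
          ; *-assoc = λ x y z → from-≡ (ℚₚ.*-assoc (val x) (val y) (val z))
          ; *-identity = (λ x → from-≡ (ℚₚ.*-identityˡ (val x))) , (λ x → from-≡ (ℚₚ.*-identityʳ (val x)))
          ; distrib = (λ x y z → from-≡ (ℚₚ.*-distribˡ-+ (val x) (val y) (val z)))
                    , (λ x y z → from-≡ (ℚₚ.*-distribʳ-+ (val x) (val y) (val z)))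
          }
        ; *-comm = λ x y → from-≡ (ℚₚ.*-comm (val x) (val y))
        }
      }

    open SequencesIn Zp-ring renaming (ι to ιₚ; pow to powₚ; sum≤ to sumₚ≤)
    open BinomialConvolution Zp-ring using (appellSum; appellSum-cong)

    val-ι : ∀ k → val (ιₚ k) ≡ ℕ→ℚ k
    val-ι zero = refl
    val-ι (suc k) = ≡.trans (≡.cong (λ x → 1ℚ + x) (val-ι k)) (≡.sym (ℕ→ℚ-suc k))

    val-pow : ∀ x k → val (powₚ x k) ≡ val x ^ℚ k
    val-pow x zero = refl
    val-pow x (suc k) = ≡.cong (_* val x) (val-pow x k)

    val-sum : ∀ n {f g} → (∀ k → k ℕ.≤ n → val (f k) ≡ g k) → val (sumₚ≤ n f) ≡ Σ[0≤k≤ n ] g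
    val-sum zero f≡g = f≡g 0 z≤n
    val-sum (suc n) f≡g =
      ≡.cong₂ _+_ (val-sum n (λ k k≤n → f≡g k (ℕₚ.m≤n⇒m≤1+n k≤n))) (f≡g (suc n) ℕₚ.≤-refl)

    module _ (p∤2 : ¬ p ∣ 2) (n : ℕ) where
      open CommutativeRing Zp-ring using (1#) renaming (_*_ to _*ₚ_; _-_ to _-ₚ_; *-congˡ to *ₚ-congˡ; +-congʳ to +ₚ-congʳ)

      Eₚ : ℕ → Zp
      Eₚ k = E k # integral-E k

      2ₚ : Zp
      2ₚ = ℕ→ℚ 2 # integral-ℕ 2

      Epolyₚ : Zp → Zp
      Epolyₚ x = (inv (ℕ→ℚ 2 ^ℚ n) # integral-inv-2^ n p∤2) *ₚ appellSum Eₚ n (2ₚ *ₚ x -ₚ 1#)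

      val-Epolyₚ : ∀ x → val (Epolyₚ x) ≡ Epoly n (val x)
      val-Epolyₚ x = ≡.cong (inv (ℕ→ℚ 2 ^ℚ n) *_) (val-sum n (λ k _ →
        ≡.cong₂ (λ c y → c * y * E k) (val-ι (n C k)) (val-pow (2ₚ *ₚ x -ₚ 1#) (n ∸ k))))

      integral-Epoly : ∀ x → InZp p x → InZp p (Epoly n x)
      integral-Epoly x ix = ≡.subst (InZp p) (val-Epolyₚ (x # ix)) (integral (Epolyₚ (x # ix)))

      -- Evaluated inside `Zp-ring`, the polynomial respects ≈ for free; this is possible because
      -- the Euler numbers and 1/2 are p-integral.
      CongMod-Epoly : ∀ x y → InZp p x → InZp p y → CongMod p m x y → CongMod p m (Epoly n x) (Epoly n y)
      CongMod-Epoly x y ix iy x≈y = ≡.subst₂ (CongMod p m) (val-Epolyₚ (x # ix)) (val-Epolyₚ (y # iy))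
        (congruent (*ₚ-congˡ {inv (ℕ→ℚ 2 ^ℚ n) # integral-inv-2^ n p∤2}
          (appellSum-cong Eₚ n (+ₚ-congʳ { -ₚ1} (*ₚ-congˡ {2ₚ} (modulo {x # ix} {y # iy} x≈y))))))
        where
        -ₚ1 : Zp
        -ₚ1 = CommutativeRing.-_ Zp-ring 1#

-- Transfer of the ring identities to congruences between rationals.

module Assembly (n-1 : ℕ) (p-prime : Prime (suc (suc n-1 ℕ.+ suc n-1))) where
  private
    n N p : ℕ
    n = suc n-1
    N = n ℕ.+ n
    p = suc N

    P : ℚ
    P = ℕ→ℚ p

  open Localisation p p-prime
  open Modulo 2
  open Modulo 1 using () renaming (CongMod-Epoly to CongMod-Epoly₁)
  open CommutativeRing Zp-ring using (0#; 1#)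
    renaming (_+_ to _+ₚ_; _*_ to _*ₚ_; _-_ to _-ₚ_; -_ to -ₚ_)
  open SequencesIn Zp-ring using () renaming (ι to ιₚ; pow to powₚ)

  p∤suc : ∀ {k} → k ℕ.< N → ¬ p ∣ suc k
  p∤suc k<N p∣k+1 = ℕₚ.<⇒≱ (s≤s k<N) (∣⇒≤ p∣k+1)

  p∤2 : ¬ p ∣ 2
  p∤2 = p∤suc {1} (s≤s (ℕₚ.≤-trans (s≤s z≤n) (ℕₚ.m≤n+m n n-1)))

  ℕ→ℚ-suc≢0 : ∀ k → ℕ→ℚ (suc k) ≢ 0ℚ
  ℕ→ℚ-suc≢0 k eq = contradiction
    (≡.trans (≡.sym (ℚₚ.↥-/ (+ suc k) 1)) (≡.cong (λ x → ℚ.↥ x ℤ.* gcd (+ suc k) (+ 1)) eq)) λ ()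

  P-inverse : P * inv P ≡ 1ℚ
  P-inverse = inverse-of-nonzero (ℕ→ℚ-suc≢0 N)

  P¹ : ℕ→ℚ (p ℕ.^ 1) ≡ P
  P¹ = ≡.cong ℕ→ℚ (ℕₚ.*-identityʳ p)

  P² : ℕ→ℚ (p ℕ.^ 2) ≡ P * P
  P² = ≡.trans (ℕ→ℚ-* p (p ℕ.* 1)) (≡.cong (P *_) P¹)

  -- A total function is required, whereas p ∤ k + 1 is guaranteed only for k < N; beyond that the
  -- value is a filler.
  ν : ℕ → Zp
  ν k with k ℕ.<? N
  ... | yes k<N = inv (ℕ→ℚ (suc k)) # integral-inv-ℕ (suc k) (p∤suc k<N)
  ... | no _ = 0#

  val-ν : ∀ {k} → k ℕ.< N → val (ν k) ≡ inv (ℕ→ℚ (suc k))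
  val-ν {k} k<N with k ℕ.<? N
  ... | yes _ = refl
  ... | no k≮N = contradiction k<N k≮N

  ν-inverse : ∀ {k} → k ℕ.< N → ιₚ (suc k) *ₚ ν k ≈ 1#
  ν-inverse {k} k<N = from-≡
    (≡.trans (≡.cong₂ _*_ (val-ι (suc k)) (val-ν k<N)) (inverse-of-nonzero (ℕ→ℚ-suc≢0 k)))

  ε²≈0 : ιₚ p *ₚ ιₚ p ≈ 0#
  ε²≈0 = modulo (1ℚ , integral-ℕ 1 , (begin
    val (ιₚ p) * val (ιₚ p) - 0ℚ ≡⟨ ≡.cong (λ x → x * x - 0ℚ) (val-ι p) ⟩
    P * P - 0ℚ                   ≡⟨ solve 1 (λ x → x :- con (+ 0) := x :* con (+ 1)) refl (P * P) ⟩
    P * P * 1ℚ                   ≡⟨ ≡.cong (_* 1ℚ) P² ⟨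
    ℕ→ℚ (p ℕ.^ 2) * 1ℚ           ∎))
    where
    open ≡.≡-Reasoning
    open ℚ-Solver

  open TruncatedBinomialSums Zp-ring n-1 hiding (n; N; p)
  open ModuloP² ν ν-inverse ε²≈0

  val-binomial : ∀ x k → k ℕ.≤ N → val (binomial x k) ≡ binom (val x) k
  val-binomial x zero _ = refl
  val-binomial x (suc k) k<N = ≡.cong₂ _*_
    (≡.cong₂ (λ b c → b * (val x - c)) (val-binomial x k (ℕₚ.<⇒≤ k<N)) (val-ι k)) (val-ν k<N)

  val-T : ∀ x → val (T x) ≡ Σ[0≤k≤ N ] (λ k → binom (val x) k * ((- ℕ→ℚ 2) ^ℚ k))
  val-T x = val-sum N (λ k k≤N → ≡.cong₂ _*_ (val-binomial x k k≤N) (val-pow (-ₚ 2#) k))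

  val-o : ∀ k → k ℕ.≤ n → val (o k) ≡ inv (ℕ→ℚ (2 ℕ.* k) - 1ℚ)
  val-o zero _ = refl
  val-o (suc k) k<n = ≡.trans (val-ν (ℕₚ.<-trans (ℕₚ.n<1+n (k ℕ.+ k)) (double<N k<n))) (≡.cong inv (begin
    ℕ→ℚ (suc (k ℕ.+ k))                 ≡⟨ solve 1 (λ x → x := con (+ 1) :+ x :- con (+ 1)) refl (ℕ→ℚ (suc (k ℕ.+ k))) ⟩
    1ℚ + ℕ→ℚ (suc (k ℕ.+ k)) - 1ℚ       ≡⟨ ≡.cong (_- 1ℚ) (ℕ→ℚ-suc (suc (k ℕ.+ k))) ⟨
    ℕ→ℚ (suc (suc (k ℕ.+ k))) - 1ℚ      ≡⟨ ≡.cong (λ j → ℕ→ℚ j - 1ℚ) doubled ⟩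
    ℕ→ℚ (2 ℕ.* suc k) - 1ℚ              ∎))
    where
    open ≡.≡-Reasoning
    open ℚ-Solver
    doubled : suc (suc (k ℕ.+ k)) ≡ 2 ℕ.* suc k
    doubled = ℕ-Solver.solve 1 (λ k → ℕ-Solver.con 2 ℕ-Solver.:+ (k ℕ-Solver.:+ k) ℕ-Solver.:=
      ℕ-Solver.con 2 ℕ-Solver.:* (ℕ-Solver.con 1 ℕ-Solver.:+ k)) refl k

  val-S : ∀ x → val (S x n) ≡
    Σ[0≤k≤ n ] (λ k → binom (val x) k * binom (- 1ℚ - val x) k * inv (ℕ→ℚ (2 ℕ.* k) - 1ℚ))
  val-S x = val-sum n (λ k k≤n → ≡.cong₂ _*_
    (≡.cong₂ _*_ (val-binomial x k (ℕₚ.≤-trans k≤n (ℕₚ.m≤m+n n n)))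
                 (val-binomial (-ₚ 1# -ₚ x) k (ℕₚ.≤-trans k≤n (ℕₚ.m≤m+n n n))))
    (val-o k k≤n))

  -- Together with `p-scale` this justifies reading `ε * x ≈ ε * y` as congruence modulo p; the
  -- division by p takes place in ℚ.
  p-cancel : ∀ x y → CongMod p 2 (P * x) (P * y) → CongMod p 1 x y
  p-cancel x y (z , iz , eq) = z , iz , (begin
    x - y                        ≡⟨ ℚₚ.*-identityˡ (x - y) ⟨
    1ℚ * (x - y)                 ≡⟨ ≡.cong (_* (x - y)) P-inverse ⟨
    P * inv P * (x - y)          ≡⟨ solve 4 (λ p i x y → p :* i :* (x :- y) := i :* (p :* x :- p :* y)) refl P (inv P) x y ⟩
    inv P * (P * x - P * y)      ≡⟨ ≡.cong (inv P *_) eq ⟩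
    inv P * (ℕ→ℚ (p ℕ.^ 2) * z)  ≡⟨ ≡.cong (λ q → inv P * (q * z)) P² ⟩
    inv P * (P * P * z)          ≡⟨ solve 3 (λ p i z → i :* (p :* p :* z) := p :* i :* (p :* z)) refl P (inv P) z ⟩
    P * inv P * (P * z)          ≡⟨ ≡.cong (_* (P * z)) P-inverse ⟩
    1ℚ * (P * z)                 ≡⟨ ℚₚ.*-identityˡ (P * z) ⟩
    P * z                        ≡⟨ ≡.cong (_* z) P¹ ⟨
    ℕ→ℚ (p ℕ.^ 1) * z            ∎)
    where
    open ≡.≡-Reasoning
    open ℚ-Solver

  p-scale : ∀ x y → CongMod p 1 x y → CongMod p 2 (P * x) (P * y)
  p-scale x y (z , iz , eq) = z , iz , (begin
    P * x - P * y           ≡⟨ solve 3 (λ p x y → p :* x :- p :* y := p :* (x :- y)) refl P x y ⟩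
    P * (x - y)             ≡⟨ ≡.cong (P *_) eq ⟩
    P * (ℕ→ℚ (p ℕ.^ 1) * z) ≡⟨ ≡.cong (λ q → P * (q * z)) P¹ ⟩
    P * (P * z)             ≡⟨ ℚₚ.*-assoc P P z ⟨
    P * P * z               ≡⟨ ≡.cong (_* z) P² ⟨
    ℕ→ℚ (p ℕ.^ 2) * z       ∎)
    where
    open ≡.≡-Reasoning
    open ℚ-Solver

  e : Zp → Zp
  e x = Epoly (n-1 ℕ.+ n) (val x) # integral-Epoly p∤2 (n-1 ℕ.+ n) (val x) (integral x)

  e-congruence : ∀ {x y} → ε *ₚ x ≈ ε *ₚ y → ε *ₚ e x ≈ ε *ₚ e y
  e-congruence {x} {y} εx≈εy = modulo (≡.subst (λ q → CongMod p 2 (q * val (e x)) (q * val (e y))) (≡.sym (val-ι p))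
    (p-scale (val (e x)) (val (e y)) (CongMod-Epoly₁ p∤2 (n-1 ℕ.+ n) (val x) (val y) (integral x) (integral y)
      (p-cancel (val x) (val y) (≡.subst (λ q → CongMod p 2 (q * val x) (q * val y)) (val-ι p) (congruent εx≈εy))))))

  odd-power : ∀ k → ℚ-Sequences.pow (- 1ℚ) (k ℕ.+ suc k) ≡ - 1ℚ
  odd-power zero = refl
  odd-power (suc k) rewrite ℕₚ.+-suc k (suc k) = ≡.cong (λ x → x * - 1ℚ * - 1ℚ) (odd-power k)

  e-reflection : ∀ x → e (1# -ₚ x) ≈ -ₚ e x
  e-reflection x = from-≡ (ℚ-Euler.Epoly-reflection (n-1 ℕ.+ n) (val x) (odd-power n-1))

  e-step : ∀ x → e (1# +ₚ x) +ₚ e x ≈ 2# *ₚ powₚ x (n-1 ℕ.+ n)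
  e-step x = from-≡ (≡.trans (ℚ-Euler.Epoly-step (n-1 ℕ.+ n) (val x))
    (≡.cong (ℕ→ℚ 2 *_) (≡.trans (pow≡^ℚ (val x) (n-1 ℕ.+ n)) (≡.sym (val-pow x (n-1 ℕ.+ n))))))

  open EulerPolynomial e (λ {x} {y} → e-congruence {x} {y}) e-reflection e-step

  module _ (a : ℚ) (ia : InZp p a) (r : ℕ) (r<p : r ℕ.< p) (a≡r : CongMod p 1 a (ℕ→ℚ r)) where
    open ≡.≡-Reasoning
    open ℚ-Solver

    t A-a : ℚ
    t = (a - ℕ→ℚ r) * inv P
    A-a = ℕ→ℚ 2 * a + 1ℚ

    -- The quotient t is the very witness of a ≡ r modulo p.
    integral-t : InZp p t
    integral-t = let z , iz , eq = a≡r in ≡.subst (InZp p) (≡.sym (begin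
      t                              ≡⟨ ≡.cong (_* inv P) eq ⟩
      ℕ→ℚ (p ℕ.^ 1) * z * inv P      ≡⟨ ≡.cong (λ q → q * z * inv P) P¹ ⟩
      P * z * inv P                  ≡⟨ solve 3 (λ p z i → p :* z :* i := p :* i :* z) refl P z (inv P) ⟩
      P * inv P * z                  ≡⟨ ≡.cong (_* z) P-inverse ⟩
      1ℚ * z                         ≡⟨ ℚₚ.*-identityˡ z ⟩
      z                              ∎)) iz

    aₚ tₚ : Zp
    aₚ = a # ia
    tₚ = t # integral-t

    a≈r+εt : aₚ ≈ ιₚ r +ₚ ε *ₚ tₚ
    a≈r+εt = from-≡ (begin
      a                                  ≡⟨ solve 2 (λ a r → a := r :+ con (+ 1) :* (a :- r)) refl a (ℕ→ℚ r) ⟩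
      ℕ→ℚ r + 1ℚ * (a - ℕ→ℚ r)           ≡⟨ ≡.cong (λ q → ℕ→ℚ r + q * (a - ℕ→ℚ r)) P-inverse ⟨
      ℕ→ℚ r + P * inv P * (a - ℕ→ℚ r)    ≡⟨ solve 4 (λ a r p i → r :+ p :* i :* (a :- r) := r :+ p :* ((a :- r) :* i)) refl a (ℕ→ℚ r) P (inv P) ⟩
      ℕ→ℚ r + P * t                      ≡⟨ ≡.cong₂ (λ x q → x + q * t) (val-ι r) (val-ι p) ⟨
      val (ιₚ r) + val ε * t             ∎)

    Sum T-2a : ℚ
    Sum = Σ[0≤k≤ n ] (λ k → binom a k * binom (- 1ℚ - a) k * inv (ℕ→ℚ (2 ℕ.* k) - 1ℚ))
    T-2a = Σ[0≤k≤ N ] (λ k → binom (ℕ→ℚ 2 * a) k * ((- ℕ→ℚ 2) ^ℚ k))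

    case-small : 2 ℕ.* r ℕ.< p → CongMod p 2 Sum (ℕ→ℚ 2 * P * t - A-a * T-2a)
    case-small 2r<p = ≡.subst₂ (CongMod p 2) (val-S aₚ)
      (≡.cong₂ (λ q x → ℕ→ℚ 2 * q * t - A-a * x) (val-ι p) (val-T (2# *ₚ aₚ)))
      (congruent (small-residue {aₚ} {tₚ} {r} r≤n a≈r+εt))
      where
      r≤n : r ℕ.≤ n
      r≤n = ℕₚ.≮⇒≥ λ n<r → ℕₚ.<⇒≱ 2r<p (ℕₚ.≤-trans (ℕₚ.n≤1+n p)
        (≡.subst₂ ℕ._≤_ (ℕₚ.+-suc (suc n) n) (≡.cong (r ℕ.+_) (≡.sym (ℕₚ.+-identityʳ r))) (ℕₚ.+-mono-≤ n<r n<r)))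

    module _ (p<2r : p ℕ.< 2 ℕ.* r) where

      r′ d : ℕ
      r′ = N ∸ r
      d = n-1 ∸ r′

      n<r : n ℕ.< r
      n<r = ℕₚ.≰⇒> λ r≤n → ℕₚ.<⇒≱ p<2r (ℕₚ.m≤n⇒m≤1+n
        (≡.subst (ℕ._≤ N) (≡.cong (r ℕ.+_) (≡.sym (ℕₚ.+-identityʳ r))) (ℕₚ.+-mono-≤ r≤n r≤n)))

      r+r′≡N : r ℕ.+ r′ ≡ N
      r+r′≡N = ℕₚ.m+[n∸m]≡n (ℕₚ.≤-pred r<p)

      r′≤n-1 : r′ ℕ.≤ n-1
      r′≤n-1 = ℕₚ.+-cancelˡ-≤ (suc n) r′ n-1 (ℕₚ.≤-trans (ℕₚ.+-monoˡ-≤ r′ n<r)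
        (ℕₚ.≤-reflexive (≡.trans r+r′≡N (ℕₚ.+-suc n n-1))))

      n-1≡r′+d : n-1 ≡ r′ ℕ.+ d
      n-1≡r′+d = ≡.sym (ℕₚ.m+[n∸m]≡n r′≤n-1)

      halves : ∀ z → t - - inv (ℕ→ℚ 2) ≡ z → ℕ→ℚ 2 * t + 1ℚ ≡ ℕ→ℚ 2 * z
      halves z eq = ≡.trans
        (solve 2 (λ t h → con (+ 2) :* t :+ con (+ 2) :* h := con (+ 2) :* (t :- (:- h))) refl t (inv (ℕ→ℚ 2)))
        (≡.cong (ℕ→ℚ 2 *_) eq)

      -- The congruence for t makes 2t + 1 a p-integral multiple of p, so ε(2t + 1) vanishes modulo
      -- p².
      case-half : CongMod p 1 t (- inv (ℕ→ℚ 2)) →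
        CongMod p 2 Sum (A-a + P * (1ℚ + A-a * Epoly (p ∸ 2) (- (ℕ→ℚ 2 * a))))
      case-half (z , iz , eq) = ≡.subst₂ (CongMod p 2) (val-S aₚ)
        (≡.cong (λ q → A-a + q * (1ℚ + A-a * Epoly (n-1 ℕ.+ n) (- (ℕ→ℚ 2 * a)))) (val-ι p))
        (congruent (half-residue {aₚ} {tₚ} {r} {r′} {d} r+r′≡N n-1≡r′+d a≈r+εt (modulo (ℕ→ℚ 2 * z , integral-* (ℕ→ℚ 2) z (integral-ℕ 2) iz , (begin
          val ε * (ℕ→ℚ 2 * t + 1ℚ) - 0ℚ    ≡⟨ ≡.cong₂ (λ q x → q * x - 0ℚ) (val-ι p) (halves (ℕ→ℚ (p ℕ.^ 1) * z) eq) ⟩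
          P * (ℕ→ℚ 2 * (ℕ→ℚ (p ℕ.^ 1) * z)) - 0ℚ ≡⟨ ≡.cong (λ q → P * (ℕ→ℚ 2 * (q * z)) - 0ℚ) P¹ ⟩
          P * (ℕ→ℚ 2 * (P * z)) - 0ℚ       ≡⟨ solve 2 (λ p z → p :* (con (+ 2) :* (p :* z)) :- con (+ 0) := p :* p :* (con (+ 2) :* z)) refl P z ⟩
          P * P * (ℕ→ℚ 2 * z)              ≡⟨ ≡.cong (_* (ℕ→ℚ 2 * z)) P² ⟨
          ℕ→ℚ (p ℕ.^ 2) * (ℕ→ℚ 2 * z)      ∎)))))

      τ : ℚ
      τ = ℕ→ℚ 2 * t + 1ℚ

      case-invertible : ∀ i → InZp p i → τ * i ≡ 1ℚ →
        CongMod p 2 Sum (ℕ→ℚ 2 * P * (t + 1ℚ) - A-a * i - A-a * (1ℚ + i) * T-2a)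
      case-invertible i ii τi≡1 = ≡.subst₂ (CongMod p 2) (val-S aₚ)
        (≡.cong₂ (λ q x → ℕ→ℚ 2 * q * (t + 1ℚ) - A-a * i - A-a * (1ℚ + i) * x) (val-ι p) (val-T (2# *ₚ aₚ)))
        (congruent (LargeResidue.large-residue {aₚ} {tₚ} {r} {r′} {d} r+r′≡N n-1≡r′+d a≈r+εt {i = i # ii}
          (from-≡ τi≡1)))

      -- 2t + 1 is a unit: if p divided its numerator, then 2t + 1 = pz with z integral, and t + 1/2
      -- = p(z/2) would contradict the hypothesis on t.
      case-generic : ¬ CongMod p 1 t (- inv (ℕ→ℚ 2)) →
        CongMod p 2 Sum (ℕ→ℚ 2 * P * (t + 1ℚ) - A-a * inv τ - A-a * (1ℚ + inv τ) * T-2a)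
      case-generic t≢-½ = case-invertible (inv τ) (integral-inv τ p∤τ) (inverse-of-nonzero {τ} τ≢0)
        where
        integral-τ : InZp p τ
        integral-τ = integral-+ (ℕ→ℚ 2 * t) 1ℚ (integral-* (ℕ→ℚ 2) t (integral-ℕ 2) integral-t) (integral-ℕ 1)
        half-of-τ : ∀ z → τ ≡ P * z → t - - inv (ℕ→ℚ 2) ≡ ℕ→ℚ (p ℕ.^ 1) * (z * inv (ℕ→ℚ 2))
        half-of-τ z eq = begin
          -- The factor 1 is inserted in order to be read as 2 · 1/2, which equals it by
          -- computation.
          t - - inv (ℕ→ℚ 2)               ≡⟨ ≡.cong (_- - inv (ℕ→ℚ 2)) (ℚₚ.*-identityˡ t) ⟨
          1ℚ * t - - inv (ℕ→ℚ 2)           ≡⟨ solve 2 (λ t h → con (+ 2) :* h :* t :- (:- h) := (con (+ 2) :* t :+ con (+ 1)) :* h) refl t (inv (ℕ→ℚ 2)) ⟩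
          τ * inv (ℕ→ℚ 2)                 ≡⟨ ≡.cong (_* inv (ℕ→ℚ 2)) eq ⟩
          P * z * inv (ℕ→ℚ 2)             ≡⟨ ℚₚ.*-assoc P z (inv (ℕ→ℚ 2)) ⟩
          P * (z * inv (ℕ→ℚ 2))           ≡⟨ ≡.cong (_* (z * inv (ℕ→ℚ 2))) P¹ ⟨
          ℕ→ℚ (p ℕ.^ 1) * (z * inv (ℕ→ℚ 2)) ∎
        excluded : ∀ z → InZp p z → ¬ τ ≡ P * z
        excluded z iz eq = t≢-½ (z * inv (ℕ→ℚ 2) ,
          integral-* z (inv (ℕ→ℚ 2)) iz (integral-inv-ℕ 2 p∤2) , half-of-τ z eq)
        p∤τ : ¬ p ∣ ℤ.∣ ℚ.↥ τ ∣
        p∤τ p∣τ = let z , iz , eq = p-multiple τ integral-τ p∣τ in excluded z iz eq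
        τ≢0 : τ ≢ 0ℚ
        τ≢0 τ≡0 = excluded 0ℚ (integral-ℕ 0) (≡.trans τ≡0 (≡.sym (ℚₚ.*-zeroʳ P)))

-- The upper limit `h` is kept separate so that n can be exchanged for `⌊ p ∸ 1 /2⌋` by one
-- substitution.
Cases : (p h : ℕ) (a : ℚ) (r : ℕ) → Set
Cases p h a r =
  let t = (a - ℕ→ℚ r) * inv (ℕ→ℚ p)
      S = Σ[0≤k≤ h ] (λ k → binom a k * binom (- 1ℚ - a) k * inv (ℕ→ℚ (2 ℕ.* k) - 1ℚ))
      T = Σ[0≤k≤ p ∸ 1 ] (λ k → binom (ℕ→ℚ 2 * a) k * ((- ℕ→ℚ 2) ^ℚ k))
      P = ℕ→ℚ p
      A = ℕ→ℚ 2 * a + 1ℚ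
  in (2 ℕ.* r ℕ.< p → CongMod p 2 S (ℕ→ℚ 2 * P * t - A * T))
   × (p ℕ.< 2 ℕ.* r → ¬ CongMod p 1 t (- inv (ℕ→ℚ 2)) →
        CongMod p 2 S (ℕ→ℚ 2 * P * (t + 1ℚ) - A * inv (ℕ→ℚ 2 * t + 1ℚ)
                        - A * (1ℚ + inv (ℕ→ℚ 2 * t + 1ℚ)) * T))
   × (p ℕ.< 2 ℕ.* r → CongMod p 1 t (- inv (ℕ→ℚ 2)) →
        CongMod p 2 S (A + P * (1ℚ + A * Epoly (p ∸ 2) (- (ℕ→ℚ 2 * a)))))

even-or-odd : ∀ m → (Σ ℕ λ k → m ≡ k ℕ.+ k) ⊎ (Σ ℕ λ k → m ≡ suc (k ℕ.+ k))
even-or-odd zero = inj₁ (0 , refl)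
even-or-odd (suc m) with even-or-odd m
... | inj₁ (k , m≡2k) = inj₂ (k , ≡.cong suc m≡2k)
... | inj₂ (k , m≡2k+1) = inj₁ (suc k , ≡.trans (≡.cong suc m≡2k+1) (≡.cong suc (≡.sym (ℕₚ.+-suc k k))))

odd-prime : ∀ {p} → Prime p → 3 ℕ.< p → Σ ℕ λ k → p ≡ suc (suc k ℕ.+ suc k)
odd-prime {p} p-prime 3<p with even-or-odd p
... | inj₂ (zero , refl) = contradiction 3<p λ { (s≤s ()) }
... | inj₂ (suc k , p≡2k+3) = k , p≡2k+3
... | inj₁ (k , p≡2k)
    with prime⇒irreducible p-prime {2} (divides k (≡.trans p≡2k (≡.trans (≡.cong (k ℕ.+_) (≡.sym (ℕₚ.+-identityʳ k))) (ℕₚ.*-comm 2 k))))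
...    | inj₂ refl = contradiction 3<p λ { (s≤s (s≤s ())) }

cases : ∀ {p k} → p ≡ suc (suc k ℕ.+ suc k) → Prime p →
  (a : ℚ) → InZp p a → (r : ℕ) → r ℕ.< p → CongMod p 1 a (ℕ→ℚ r) → Cases p ⌊ p ∸ 1 /2⌋ a r
cases {k = k} refl p-prime a ia r r<p a≡r =
  ≡.subst (λ h → Cases (suc (suc k ℕ.+ suc k)) h a r) (ℕₚ.n≡⌊n+n/2⌋ (suc k))
    (case-small a ia r r<p a≡r , case-generic a ia r r<p a≡r , case-half a ia r r<p a≡r)
  where open Assembly k p-prime

theorem4p4 : (p : ℕ) → Prime p → 3 ℕ.< p →
    (a : ℚ) → InZp p a → ¬ CongMod p 1 a (ℕ→ℚ 0) →
    (r : ℕ) → r ℕ.< p → CongMod p 1 a (ℕ→ℚ r) →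
    let t = (a - ℕ→ℚ r) * inv (ℕ→ℚ p)
        S = Σ[0≤k≤ ⌊ p ∸ 1 /2⌋ ] (λ k → binom a k * binom (- 1ℚ - a) k * inv (ℕ→ℚ (2 ℕ.* k) - 1ℚ))
        T = Σ[0≤k≤ p ∸ 1 ] (λ k → binom (ℕ→ℚ 2 * a) k * ((- ℕ→ℚ 2) ^ℚ k))
        P = ℕ→ℚ p
        A = ℕ→ℚ 2 * a + 1ℚ
    in (2 ℕ.* r ℕ.< p → CongMod p 2 S (ℕ→ℚ 2 * P * t - A * T))
     × (p ℕ.< 2 ℕ.* r → ¬ CongMod p 1 t (- inv (ℕ→ℚ 2)) →
          CongMod p 2 S (ℕ→ℚ 2 * P * (t + 1ℚ) - A * inv (ℕ→ℚ 2 * t + 1ℚ)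
                          - A * (1ℚ + inv (ℕ→ℚ 2 * t + 1ℚ)) * T))
     × (p ℕ.< 2 ℕ.* r → CongMod p 1 t (- inv (ℕ→ℚ 2)) →
          CongMod p 2 S (A + P * (1ℚ + A * Epoly (p ∸ 2) (- (ℕ→ℚ 2 * a)))))
theorem4p4 p p-prime 3<p a ia _ r r<p a≡r =
  let k , p≡2k+3 = odd-prime p-prime 3<p in cases p≡2k+3 p-prime a ia r r<p a≡r
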